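{- Let $\alpha,\beta$ be $H$-colorings of $G$, let $q\in V(G)$, and let $Q\in\pi(H)$ be a reduced walk in $H$ from $\alpha(q)$ to $\beta(q)$. Then $Q$ is realizable for $\alpha,\beta,q$ if and only if all of the following hold: (i) $Q$ is topologically valid for $\alpha,\beta,q$; (ii) $Q$ has even length; (iii) if there exists an $\alpha$-tight closed walk in $G$, then for every vertex $v$ on such a walk and every walk $W$ in $G$ from $v$ to $q$, $Q=\overline{\alpha(W)}^{ -1}\cdot\overline{\beta(W)}$. Furthermore, there is a polynomial-time algorithm that, given $G,H,\alpha,\beta,q$ and a walk $Q$ satisfying (i)–(iii), outputs an $H$-recoloring sequence $S$ from $\alpha$ to $\beta$ such that $S(q)=Q$ and $S(v)$ is a reduced walk for every $v\in V(G)$.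
   Context: All graphs are finite and undirected. $G$ is a connected loopless graph with at least one edge. $H$ is a connected graph with at least one edge, possibly with loops, having the monochromatic neighborhood property: for all $a,b\in V(H)$, $|N_H(a)\cap N_H(b)|\le 1$, where $N_H(a)=\{w: aw\in E(H)\}$. An $H$-coloring of $G$ is a map $\sigma:V(G)\to V(H)$ such that $uv\in E(G)$ implies $\sigma(u)\sigma(v)\in E(H)$. An $H$-recoloring sequence is a sequence $\sigma_0,\dots,\sigma_l$ of $H$-colorings of $G$ in which consecutive colorings differ in the color of exactly one vertex. Walks: an oriented edge is an ordered pair $(x,y)$ with $xy$ an edge; $(x,y)^{ -1}=(y,x)$. A walk from $x$ to $y$ is a sequence of oriented edges, consecutive ones sharing endpoints, starting at $x$ and ending at $y$; its length is the number of edges; $\varepsilon$ is the empty walk; $W^{ -1}$ the reversed walk. A walk is reduced if no two consecutive edges $e_ie_{i+1}$ satisfy $e_{i+1}=e_i^{ -1}$; $\overline{W}$ is the unique reduced walk obtained by repeatedly deleting such pairs. $A\cdot B:=\overline{AB}$ for reduced $A,B$ with $B$ starting where $A$ ends. $\pi(H)$ is the set of reduced walks in $H$. For a walk $W=(x_0,x_1)\dots(x_{k-1},x_k)$ in $G$, $\alpha(W)=(\alpha(x_0),\alpha(x_1))\dots(\alpha(x_{k-1}),\alpha(x_k))$. A nonempty closed walk $e_1\dots e_k$ is cyclically reduced if it is reduced and $e_k\ne e_1^{ -1}$; a closed walk $C$ in $G$ is $\alpha$-tight if $\alpha(C)$ is cyclically reduced. Vertex walks: in a one-step sequence $\sigma_0,\sigma_1$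 where vertex $w$ changes from $a$ to $b\ne a$, all neighbors of $w$ have a common color $h$ (the unique element of $N_H(a)\cap N_H(b)$); set $S(w)=(a,h)(h,b)$ and $S(v)=\varepsilon$ for $v\ne w$. For the empty sequence $S(v)=\varepsilon$; for longer sequences $S(v)$ is the concatenation of the one-step walks in order. $Q\in\pi(H)$ is realizable for $\alpha,\beta,q$ if there is an $H$-recoloring sequence $S=\sigma_0,\dots,\sigma_l$ with $\sigma_0=\alpha$, $\sigma_l=\beta$, $\overline{S(q)}=Q$. A reduced walk $Q$ from $\alpha(q)$ to $\beta(q)$ is topologically valid for $\alpha,\beta,q$ if for every closed walk $C$ in $G$ from $q$ to $q$, $\overline{\beta(C)}=Q^{ -1}\cdot\overline{\alpha(C)}\cdot Q$. -}

module Defs where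

open import Data.Bool.Base using (Bool; true; false; T)
open import Data.Fin.Base using (Fin; toℕ)
open import Data.Fin.Properties using (_≟_)
open import Data.Fin.Subset using (Subset; _∩_; ∣_∣)
open import Data.List.Base as List using (List; []; _∷_; head; last)
open import Data.List.Membership.Propositional using (_∈_)
open import Data.List.Relation.Unary.Linked using (Linked; []; [-]; _∷_)
open import Data.Maybe.Base using (just)
open import Data.Nat.Base using (ℕ; zero; suc; _+_; _≤_)
open import Data.Product.Base using (Σ-syntax; ∃; ∃₂; _×_; _,_; proj₁; proj₂; swap)
open import Data.Vec.Base using (Vec; lookup; tabulate; toList)
open import Function.Base using (_∘_)
open import Relation.Binary.Construct.Closure.ReflexiveTransitive
  using (Star; ε; _◅_; _◅◅_; gmap; reverse)
open import Relation.Binary.PropositionalEquality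
  using (_≡_; _≢_; refl; sym; cong; subst)
open import Relation.Nullary using (¬_; yes; no)

------------------------------------------------------------------------
-- Graphs and walks

record Graph : Set where
  field
    order    : ℕ
    edge     : Fin order → Fin order → Bool
    edge-sym : ∀ x y → T (edge x y) → T (edge y x)

  Vertex : Set
  Vertex = Fin order

  Adj : Vertex → Vertex → Set
  Adj x y = T (edge x y)

  N : Vertex → Subset order
  N x = tabulate (edge x)

open Graph public using (Vertex; Adj)

-- There is one empty walk per vertex; equality of walks with common
-- endpoints is equality of their sequences of oriented edges, since
-- T b has at most one element.
Walk : (G : Graph) → Vertex G → Vertex G → Set
Walk G = Star (Adj G)

OrientedEdge : Graph → Set
OrientedEdge G = Vertex G × Vertex G

module Walks (G : Graph) where

  edges : ∀ {x y} → Walk G x y → List (OrientedEdge G)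
  edges ε                 = []
  edges (_◅_ {x} {y} _ W) = (x , y) ∷ edges W

  length : ∀ {x y} → Walk G x y → ℕ
  length W = List.length (edges W)

  vertices : ∀ {x y} → Walk G x y → List (Vertex G)
  vertices {x} W = x ∷ List.map proj₂ (edges W)

  infix 9 _⁻¹
  _⁻¹ : ∀ {x y} → Walk G x y → Walk G y x
  W ⁻¹ = reverse (λ {x} {y} → Graph.edge-sym G x y) W

  Reduced : ∀ {x y} → Walk G x y → Set
  Reduced W = Linked (λ e f → f ≢ swap e) (edges W)

  CyclicallyReduced : ∀ {x} → Walk G x x → Set
  CyclicallyReduced C =
    Reduced C ×
    (∃₂ λ e₁ eₖ → head (edges C) ≡ just e₁ × last (edges C) ≡ just eₖ × eₖ ≢ swap e₁)

  -- For reduced W: the reduced form of e ◅ W.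
  cons : ∀ {x y z} → Adj G x y → Walk G y z → Walk G x z
  cons e ε = e ◅ ε
  cons {x} e (_◅_ {_} {w} f W) with w ≟ x
  ... | yes refl = W
  ... | no _     = e ◅ f ◅ W

  reduce : ∀ {x y} → Walk G x y → Walk G x y
  reduce ε       = ε
  reduce (e ◅ W) = cons e (reduce W)

  infixl 6 _·_
  _·_ : ∀ {x y z} → Walk G x y → Walk G y z → Walk G x z
  A · B = reduce (A ◅◅ B)

  -- W ↝ W′ : W′ arises from W by deleting one pair e e⁻¹.  The two lemmas
  -- following it show that reduce W is a reduced walk obtained from W by
  -- repeated deletion.
  data _↝_ : ∀ {x y} → Walk G x y → Walk G x y → Set where
    here  : ∀ {x y z} (e : Adj G x y) (f : Adj G y x) (W : Walk G x z) →
            (e ◅ f ◅ W) ↝ W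
    there : ∀ {x y z} (e : Adj G x y) {W W′ : Walk G y z} →
            W ↝ W′ → (e ◅ W) ↝ (e ◅ W′)

  private
    tail-reduced : ∀ {x y z} (e : Adj G x y) (W : Walk G y z) →
                   Reduced (e ◅ W) → Reduced W
    tail-reduced e ε       _       = []
    tail-reduced e (_ ◅ _) (_ ∷ r) = r

    cons-reduced : ∀ {x y z} (e : Adj G x y) (W : Walk G y z) →
                   Reduced W → Reduced (cons e W)
    cons-reduced e ε _ = [-]
    cons-reduced {x} e (_◅_ {_} {w} f W) r with w ≟ x
    ... | yes refl = tail-reduced f W r
    ... | no w≢x   = (λ f≡e⁻¹ → w≢x (cong proj₂ f≡e⁻¹)) ∷ r

    cons-↝ : ∀ {x y z} (e : Adj G x y) (W : Walk G y z) →
             Star _↝_ (e ◅ W) (cons e W)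
    cons-↝ e ε = ε
    cons-↝ {x} e (_◅_ {_} {w} f W) with w ≟ x
    ... | yes refl = here e f W ◅ ε
    ... | no _     = ε

  reduce-reduced : ∀ {x y} (W : Walk G x y) → Reduced (reduce W)
  reduce-reduced ε       = []
  reduce-reduced (e ◅ W) = cons-reduced e (reduce W) (reduce-reduced W)

  reduce-↝ : ∀ {x y} (W : Walk G x y) → Star _↝_ W (reduce W)
  reduce-↝ ε       = ε
  reduce-↝ (e ◅ W) =
    gmap (e ◅_) (there e) (reduce-↝ W) ◅◅ cons-↝ e (reduce W)

Connected : Graph → Set
Connected G = ∀ x y → Walk G x y

HasEdge : Graph → Set
HasEdge G = ∃₂ (Adj G)

Loopless : Graph → Set
Loopless G = ∀ x → ¬ Adj G x x

-- The pairs a, b are pairs of distinct vertices: for a = b the inequality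
-- would bound the degree of every vertex by 1.
MonochromaticNeighborhood : Graph → Set
MonochromaticNeighborhood H = ∀ a b → a ≢ b → ∣ N a ∩ N b ∣ ≤ 1
  where open Graph H

record IsSource (G : Graph) : Set where
  field
    connected : Connected G
    loopless  : Loopless G
    hasEdge   : HasEdge G

  neighbor : ∀ w → ∃ (Adj G w)
  neighbor w with connected w (proj₁ hasEdge)
  ... | ε     = proj₂ hasEdge
  ... | e ◅ _ = _ , e

record IsTarget (H : Graph) : Set where
  field
    connected     : Connected H
    hasEdge       : HasEdge H
    monochromatic : MonochromaticNeighborhood H

------------------------------------------------------------------------
-- Colorings and recoloring sequences

module Colorings (G H : Graph) where

  -- Maps V(G) → V(H) are vectors, so that pointwise equal maps are equal.
  Assignment : Set
  Assignment = Vec (Vertex H) (Graph.order G)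

  IsColoring : Assignment → Set
  IsColoring σ = ∀ u v → Adj G u v → Adj H (lookup σ u) (lookup σ v)

  image : ∀ σ → IsColoring σ → ∀ {x y} → Walk G x y → Walk H (lookup σ x) (lookup σ y)
  image σ hσ = gmap (lookup σ) (λ {u} {v} → hσ u v)

  Tight : ∀ σ → IsColoring σ → ∀ {x} → Walk G x x → Set
  Tight σ hσ C = Walks.CyclicallyReduced H (image σ hσ C)

  record Step (σ τ : Assignment) : Set where
    field
      before  : IsColoring σ
      after   : IsColoring τ
      vertex  : Vertex G
      changes : lookup σ vertex ≢ lookup τ vertex
      fixes   : ∀ v → v ≢ vertex → lookup σ v ≡ lookup τ v

  Recoloring : Assignment → Assignment → Set
  Recoloring = Star Step

  colorings : ∀ {α β} → Recoloring α β → List Assignment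
  colorings {α} ε       = α ∷ []
  colorings {α} (_ ◅ S) = α ∷ colorings S

  module _ (isG : IsSource G) where

    open IsSource isG

    -- The color h is read off at an arbitrary neighbor u of the recolored
    -- vertex w.  It is adjacent to both the old color a and the new color b of
    -- w, so by the monochromatic neighborhood property it is the unique element
    -- of N a ∩ N b and does not depend on u.
    stepWalk : ∀ {σ τ} → Step σ τ → ∀ v → Walk H (lookup σ v) (lookup τ v)
    stepWalk {σ} {τ} s v with v ≟ Step.vertex s
    ... | no v≢w   = subst (Walk H (lookup σ v)) (Step.fixes s v v≢w) ε
    ... | yes refl = before w u wu ◅ h-b ◅ ε
      where
      open Step s renaming (vertex to w)
      u : Vertex G
      u = proj₁ (neighbor w)
      wu : Adj G w u
      wu = proj₂ (neighbor w)
      u≢w : u ≢ w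
      u≢w u≡w = loopless w (subst (Adj G w) u≡w wu)
      h-b : Adj H (lookup σ u) (lookup τ w)
      h-b = subst (λ h → Adj H h (lookup τ w)) (sym (fixes u u≢w))
              (after u w (Graph.edge-sym G w u wu))

    vertexWalk : ∀ {α β} → Recoloring α β → ∀ v → Walk H (lookup α v) (lookup β v)
    vertexWalk ε       v = ε
    vertexWalk (s ◅ S) v = stepWalk s v ◅◅ vertexWalk S v

record Instance : Set where
  field
    G H      : Graph
    isSource : IsSource G
    isTarget : IsTarget H

  open Colorings G H public
  open Walks H public

  field
    α β      : Assignment
    α-ok     : IsColoring α
    β-ok     : IsColoring β
    q        : Vertex G
    Q        : Walk H (lookup α q) (lookup β q)
    reduced  : Reduced Q

  α⟦_⟧ : ∀ {x y} → Walk G x y → Walk H (lookup α x) (lookup α y)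
  α⟦_⟧ = image α α-ok

  β⟦_⟧ : ∀ {x y} → Walk G x y → Walk H (lookup β x) (lookup β y)
  β⟦_⟧ = image β β-ok

  _at_ : Recoloring α β → ∀ v → Walk H (lookup α v) (lookup β v)
  S at v = vertexWalk isSource S v

  Realizable : Set
  Realizable = Σ[ S ∈ Recoloring α β ] reduce (S at q) ≡ Q

  TopologicallyValid : Set
  TopologicallyValid = (C : Walk G q q) →
    reduce β⟦ C ⟧ ≡ Q ⁻¹ · reduce α⟦ C ⟧ · Q

  -- The product on the right-hand side only makes sense when α v ≡ β v; this is
  -- part of the asserted equation.
  DeterminedByTightWalks : Set
  DeterminedByTightWalks =
    ∀ {x} (C : Walk G x x) → Tight α α-ok C →
    ∀ v → v ∈ Walks.vertices G C → (W : Walk G v q) →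
    Σ[ αv≡βv ∈ lookup α v ≡ lookup β v ]
      Q ≡ (reduce α⟦ W ⟧) ⁻¹
          · subst (λ c → Walk H c (lookup β q)) (sym αv≡βv) (reduce β⟦ W ⟧)

------------------------------------------------------------------------
-- Polynomial time

-- The machine model is a WHILE language over binary trees, with programs in
-- point-free form: a program transforms a single tree, which holds the values
-- of all its variables.

infixr 5 _∙_
data Tree : Set where
  nil : Tree
  _∙_ : Tree → Tree → Tree

size : Tree → ℕ
size nil     = 1
size (s ∙ t) = suc (size s + size t)

hd tl : Tree → Tree
hd nil     = nil
hd (s ∙ t) = s
tl nil     = nil
tl (s ∙ t) = t

infixr 4 _⨾_
data Program : Set where
  `id `nil `hd `tl `eq : Program
  _⨾_                  : Program → Program → Program
  `pair                : Program → Program → Program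
  `if                  : Program → Program → Program → Program
  `while               : Program → Program → Program

-- Run P s t n : on input s, P halts with output t after n units of time.
-- nil is false and every other tree is true.  Each elementary operation, and
-- each duplication of the current tree, is charged 1 plus the size of that
-- tree, so time also bounds the size of every tree produced.  Without this,
-- repeated `pair could build trees of exponential size in linear time; with it,
-- time is polynomially related to Turing machine time.
data Run : Program → Tree → Tree → ℕ → Set where
  run-id       : ∀ {s} → Run `id s s (suc (size s))
  run-nil      : ∀ {s} → Run `nil s nil (suc (size s))
  run-hd       : ∀ {s} → Run `hd s (hd s) (suc (size s))
  run-tl       : ∀ {s} → Run `tl s (tl s) (suc (size s))
  run-eq-true  : ∀ {s} → Run `eq (s ∙ s) (nil ∙ nil) (suc (size (s ∙ s)))
  run-eq-false : ∀ {s t} → s ≢ t → Run `eq (s ∙ t) nil (suc (size (s ∙ t)))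
  run-eq-nil   : Run `eq nil nil (suc (size nil))
  run-seq      : ∀ {P R s t u m n} →
                 Run P s t m → Run R t u n → Run (P ⨾ R) s u (m + n)
  run-pair     : ∀ {P R s t u m n} →
                 Run P s t m → Run R s u n →
                 Run (`pair P R) s (t ∙ u) (suc (size s) + m + n)
  run-if-true  : ∀ {B P R s t u v m n} →
                 Run B s (t ∙ u) m → Run P s v n →
                 Run (`if B P R) s v (suc (size s) + m + n)
  run-if-false : ∀ {B P R s v m n} →
                 Run B s nil m → Run R s v n →
                 Run (`if B P R) s v (suc (size s) + m + n)
  run-stop     : ∀ {B P s m} →
                 Run B s nil m → Run (`while B P) s s (suc (size s) + m)
  run-loop     : ∀ {B P s t u s′ v l m n} →
                 Run B s (t ∙ u) l → Run P s s′ m → Run (`while B P) s′ v n →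
                 Run (`while B P) s v (suc (size s) + l + m + n)

-- Encodings.  Vertices are written in unary, which only changes the input size
-- polynomially: a graph is given by its full adjacency matrix.

encodeList : {A : Set} → (A → Tree) → List A → Tree
encodeList enc = List.foldr (λ a t → enc a ∙ t) nil

encodeBool : Bool → Tree
encodeBool false = nil
encodeBool true  = nil ∙ nil

encodeℕ : ℕ → Tree
encodeℕ zero    = nil
encodeℕ (suc k) = nil ∙ encodeℕ k

encodeFin : ∀ {n} → Fin n → Tree
encodeFin = encodeℕ ∘ toℕ

encodeGraph : Graph → Tree
encodeGraph G = encodeList (encodeList encodeBool ∘ toList) (toList (tabulate N))
  where open Graph G

encodeMap : ∀ {m n} → Vec (Fin m) n → Tree
encodeMap σ = encodeList encodeFin (toList σ)

encodeWalk : (G : Graph) {x y : Vertex G} → Walk G x y → Tree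
encodeWalk G W =
  encodeList (λ (x , y) → encodeFin x ∙ encodeFin y) (Walks.edges G W)

encodeInstance : Instance → Tree
encodeInstance I =
  encodeGraph G ∙ encodeGraph H ∙ encodeMap α ∙ encodeMap β ∙ encodeFin q ∙ encodeWalk H Q
  where open Instance I

encodeRecoloring : (G H : Graph) → let open Colorings G H in
                   ∀ {α β} → Recoloring α β → Tree
encodeRecoloring G H S = encodeList encodeMap (Colorings.colorings G H S)

{-# OPTIONS --safe #-}

-- A vertex on an α-tight closed walk is frozen, since its two neighbors on the
-- walk have distinct colors; and a step at w conjugates the image of an edge at
-- w by the step's walk.  Hence αW · S(q) = S(v) · βW for every walk W from v to
-- q, which gives the necessity of (i)–(iii).
--
-- Conversely, (i) makes S v = αW · Q · βW⁻¹ independent of the walk W from v to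
-- q.  As long as some S v is nonempty, some vertex v can perform the first two
-- edges (a,h)(h,b) of S v: otherwise v has a neighbor u of color other than h,
-- S u starts with the edge from the color of u to a, and passing from v to u
-- repeatedly closes up to an α-tight walk through vertices with nonempty S,
-- contradicting (iii).
--
-- Functions on trees that are built from elementary operations, pairing,
-- conditionals and right folds with results of polynomial size are computed by
-- polynomial-time programs.

module Submission where

open import Defs
open import Data.Bool.Base as Bool using (Bool; true; false; if_then_else_)
open import Data.Bool.Properties using (T-irrelevant; T-≡)
open import Data.Empty using (⊥-elim)
open import Data.Fin.Base using (Fin; zero; suc; toℕ)
open import Data.Fin.Properties using (_≟_; pigeonhole; toℕ-injective)
open import Data.Fin.Subset using (Subset; ∣_∣) renaming (_∈_ to _∈ₛ_)
open import Data.Fin.Subset.Properties using (x∈p∩q⁺; x∈p⇒∣p-x∣<∣p∣; x∈p∧x≢y⇒x∈p-y)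
open import Data.List.Base as List using (List; []; _∷_; head; last)
open import Data.List.Membership.Propositional using (_∈_)
open import Data.List.Relation.Unary.Any using (here; there)
open import Data.List.Relation.Unary.Linked using (Linked; []; [-]; _∷_)
open import Data.Maybe.Base using (just)
open import Data.Nat as ℕ using (ℕ; zero; suc; pred; _+_; _*_; _^_; _∸_; _≤_; _<_; z≤n; s≤s)
open import Data.Nat.Divisibility using (_∣_; divides; ∣m+n∣m⇒∣n; ∣m∣n⇒∣m+n; ∣-refl; ∣⇒≤)
open import Data.Nat.Properties hiding (_≟_)
open import Data.Nat.Tactic.RingSolver using (solve-∀)
open import Data.Product using (Σ-syntax; ∃₂; ∃-syntax; _×_; _,_; proj₁; proj₂; swap)
open import Data.Sum.Base using (_⊎_; inj₁; inj₂)
open import Data.Unit using (⊤; tt)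
open import Data.Vec.Base using (Vec; []; _∷_; lookup; tabulate; toList; _[_]≔_)
open import Data.Vec.Properties
  using (lookup⇒[]=; lookup∘tabulate; lookup∘update; lookup∘update′; tabulate∘lookup; tabulate-cong)
open import Function using (_∘_; Equivalence; mk⇔)
open import Function.Bundles using (_⇔_)
open import Relation.Binary.Bundles using (Setoid)
open import Relation.Binary.Construct.Closure.ReflexiveTransitive using (ε; _◅_; _◅◅_; revApp)
open import Relation.Binary.Construct.Closure.ReflexiveTransitive.Properties using (◅◅-assoc; gmap-◅◅)
open import Relation.Binary.PropositionalEquality
open import Relation.Nullary using (¬_; yes; no; contradiction; Dec; does)
open import Relation.Nullary.Decidable using (map′; _×-dec_)
import Relation.Binary.Reasoning.Setoid as SetoidReasoning

-- Polynomials

-- Sufficiency of (i)-(iii) is not proved apart from the algorithm: the recoloring that the program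
-- outputs is the witness. The program is therefore treated as a total function on trees, whose
-- running time and whose value on an encoded instance are established independently. The walks `W`
-- behind `S v` come from connectivity and are not part of the encoded input. The program instead
-- spreads the walks from `q` along edges, by S u = α(u,v) · S v · β(v,u). Independence of `W` makes
-- every choice of neighbor give the same result, and an entry gains at most two vertices per round,
-- which keeps the tables polynomial. A recoloring step removes the first two edges of one `S v`
-- literally, without any cancellation. So the vertex walks of the output are the initial walks
-- `S v` themselves, which are reduced, and their total length bounds the number of steps. What has
-- to survive a step is that `S` is empty on all tight walks of the current coloring; it does,
-- because a step neither creates nor destroys tight walks.

infixl 6 _⊕_
infixl 7 _⊗_
data Poly : Set where
  var     : Poly
  con     : ℕ → Poly
  _⊕_ _⊗_ : Poly → Poly → Poly

eval : Poly → ℕ → ℕ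
eval var     n = n
eval (con a) n = a
eval (p ⊕ r) n = eval p n + eval r n
eval (p ⊗ r) n = eval p n * eval r n

substitute : Poly → Poly → Poly
substitute var     r = r
substitute (con a) r = con a
substitute (p ⊕ q) r = substitute p r ⊕ substitute q r
substitute (p ⊗ q) r = substitute p r ⊗ substitute q r

eval-substitute : ∀ p r n → eval (substitute p r) n ≡ eval p (eval r n)
eval-substitute var     r n = refl
eval-substitute (con a) r n = refl
eval-substitute (p ⊕ q) r n = cong₂ _+_ (eval-substitute p r n) (eval-substitute q r n)
eval-substitute (p ⊗ q) r n = cong₂ _*_ (eval-substitute p r n) (eval-substitute q r n)

eval-mono : ∀ p {m n} → m ≤ n → eval p m ≤ eval p n
eval-mono var     m≤n = m≤n
eval-mono (con a) m≤n = ≤-refl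
eval-mono (p ⊕ q) m≤n = +-mono-≤ (eval-mono p m≤n) (eval-mono q m≤n)
eval-mono (p ⊗ q) m≤n = *-mono-≤ (eval-mono p m≤n) (eval-mono q m≤n)

-- Adding the exponents gives a power that dominates both summands of a sum. The comparison of
-- `n ^ k` with `n ^ (k + l)` can fail at `n = 0`, hence the restriction to positive `n`; sizes of
-- trees are positive.
eval-bound : ∀ p → ∃₂ λ c k → ∀ n → 1 ≤ n → eval p n ≤ c * n ^ k
eval-bound var     = 1 , 1 , λ n _ → ≤-reflexive (sym (trans (*-identityˡ (n ^ 1)) (*-identityʳ n)))
eval-bound (con a) = a , 0 , λ n _ → ≤-reflexive (sym (*-identityʳ a))
eval-bound (p ⊕ q) with eval-bound p | eval-bound q
... | c , k , hp | d , l , hq = c + d , k + l , bound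
  where
  bound : ∀ n → 1 ≤ n → eval p n + eval q n ≤ (c + d) * n ^ (k + l)
  bound n@(suc _) 1≤n = begin
    eval p n + eval q n               ≤⟨ +-mono-≤ (hp n 1≤n) (hq n 1≤n) ⟩
    c * n ^ k + d * n ^ l             ≤⟨ +-mono-≤ (*-monoʳ-≤ c (^-monoʳ-≤ n (m≤m+n k l)))
                                                  (*-monoʳ-≤ d (^-monoʳ-≤ n (m≤n+m l k))) ⟩
    c * n ^ (k + l) + d * n ^ (k + l) ≡⟨ *-distribʳ-+ (n ^ (k + l)) c d ⟨
    (c + d) * n ^ (k + l)             ∎
    where open ≤-Reasoning
eval-bound (p ⊗ q) with eval-bound p | eval-bound q
... | c , k , hp | d , l , hq = c * d , k + l , bound
  where
  bound : ∀ n → 1 ≤ n → eval p n * eval q n ≤ (c * d) * n ^ (k + l)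
  bound n 1≤n = begin
    eval p n * eval q n         ≤⟨ *-mono-≤ (hp n 1≤n) (hq n 1≤n) ⟩
    (c * n ^ k) * (d * n ^ l)   ≡⟨ [m*n]*[o*p]≡[m*o]*[n*p] c (n ^ k) d (n ^ l) ⟩
    (c * d) * (n ^ k * n ^ l)   ≡⟨ cong (c * d *_) (^-distribˡ-+-* n k l) ⟨
    (c * d) * n ^ (k + l)       ∎
    where open ≤-Reasoning

-- Polynomial-time functions on trees

1≤size : ∀ s → 1 ≤ size s
1≤size nil     = s≤s z≤n
1≤size (s ∙ t) = s≤s z≤n

size-hd : ∀ s → size (hd s) ≤ size s
size-hd nil     = ≤-refl
size-hd (s ∙ t) = m≤n⇒m≤1+n (m≤m+n (size s) (size t))

size-tl : ∀ s → size (tl s) ≤ size s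
size-tl nil     = ≤-refl
size-tl (s ∙ t) = m≤n⇒m≤1+n (m≤n+m (size t) (size s))

-- This is what makes composition polynomial: the time of the first program bounds the size of the
-- input of the second.
size-result≤time : ∀ {P s t n} → Run P s t n → size t ≤ n
size-result≤time run-id               = n≤1+n _
size-result≤time {s = s} run-nil      = s≤s z≤n
size-result≤time {s = s} run-hd       = m≤n⇒m≤1+n (size-hd s)
size-result≤time {s = s} run-tl       = m≤n⇒m≤1+n (size-tl s)
size-result≤time (run-eq-true {s})    = s≤s (s≤s (≤-trans (1≤size s) (m≤m+n (size s) (size s))))
size-result≤time (run-eq-false _)     = s≤s z≤n
size-result≤time run-eq-nil           = s≤s z≤n
size-result≤time (run-seq {m = m} r r′) = ≤-trans (size-result≤time r′) (m≤n+m _ m)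
size-result≤time (run-pair {s = s} {m = m} {n = n} r r′) =
  s≤s (+-mono-≤ (≤-trans (size-result≤time r) (m≤n+m m (size s))) (size-result≤time r′))
size-result≤time (run-if-true r r′)   = ≤-trans (size-result≤time r′) (m≤n+m _ _)
size-result≤time (run-if-false r r′)  = ≤-trans (size-result≤time r′) (m≤n+m _ _)
size-result≤time (run-stop {s = s} r) = ≤-trans (n≤1+n _) (m≤m+n _ _)
size-result≤time (run-loop r r′ r″)   = ≤-trans (size-result≤time r″) (m≤n+m _ _)

-- The run is demanded on every tree, not only on encodings, so that certificates compose without
-- any tracking of well-formedness.
record PolyTime (f : Tree → Tree) : Set where
  field
    program : Program
    time    : Poly
    run     : ∀ s → ∃[ n ] (Run program s (f s) n × n ≤ eval time (size s))

  size-bound : ∀ s → size (f s) ≤ eval time (size s)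
  size-bound s with run s
  ... | n , r , n≤ = ≤-trans (size-result≤time r) n≤

open PolyTime

infixr 4 _⟫_
_⟫_ : ∀ {f g} → PolyTime f → PolyTime g → PolyTime (λ s → g (f s))
(F ⟫ G) .program = F .program ⨾ G .program
(F ⟫ G) .time    = F .time ⊕ substitute (G .time) (F .time)
_⟫_ {f} {g} F G .run s with F .run s | G .run (f s)
... | m , r , m≤ | n , r′ , n≤ = m + n , run-seq r r′ , +-mono-≤ m≤ (begin
  n                                                ≤⟨ n≤ ⟩
  eval (G .time) (size (f s))                      ≤⟨ eval-mono (G .time) (size-bound F s) ⟩
  eval (G .time) (eval (F .time) (size s))         ≡⟨ eval-substitute (G .time) (F .time) (size s) ⟨
  eval (substitute (G .time) (F .time)) (size s)   ∎)
  where open ≤-Reasoning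

extensional : ∀ {f g} → (∀ s → f s ≡ g s) → PolyTime f → PolyTime g
extensional f≗g F .program = F .program
extensional f≗g F .time    = F .time
extensional f≗g F .run s with F .run s
... | n , r , n≤ = n , subst (λ t → Run (F .program) s t n) (f≗g s) r , n≤

idᴾ : PolyTime (λ s → s)
idᴾ .program = `id
idᴾ .time    = con 1 ⊕ var
idᴾ .run s   = _ , run-id , ≤-refl

nilᴾ : PolyTime (λ _ → nil)
nilᴾ .program = `nil
nilᴾ .time    = con 1 ⊕ var
nilᴾ .run s   = _ , run-nil , ≤-refl

hdᴾ : PolyTime hd
hdᴾ .program = `hd
hdᴾ .time    = con 1 ⊕ var
hdᴾ .run s   = _ , run-hd , ≤-refl

tlᴾ : PolyTime tl
tlᴾ .program = `tl
tlᴾ .time    = con 1 ⊕ var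
tlᴾ .run s   = _ , run-tl , ≤-refl

infixr 5 _∙ᴾ_
_∙ᴾ_ : ∀ {f g} → PolyTime f → PolyTime g → PolyTime (λ s → f s ∙ g s)
(F ∙ᴾ G) .program = `pair (F .program) (G .program)
(F ∙ᴾ G) .time    = (con 1 ⊕ var) ⊕ F .time ⊕ G .time
(F ∙ᴾ G) .run s with F .run s | G .run s
... | m , r , m≤ | n , r′ , n≤ =
  _ , run-pair r r′ , +-mono-≤ (+-monoʳ-≤ (suc (size s)) m≤) n≤

ifᵗ : Tree → Tree → Tree → Tree
ifᵗ nil     s t = t
ifᵗ (_ ∙ _) s t = s

ifᴾ : ∀ {b f g} → PolyTime b → PolyTime f → PolyTime g →
      PolyTime (λ s → ifᵗ (b s) (f s) (g s))
ifᴾ B F G .program = `if (B .program) (F .program) (G .program)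
ifᴾ B F G .time    = (con 1 ⊕ var) ⊕ B .time ⊕ (F .time ⊕ G .time)
ifᴾ {b} B F G .run s with b s | B .run s
... | nil | l , r , l≤ with G .run s
...   | n , r′ , n≤ = _ , run-if-false r r′ ,
        +-mono-≤ (+-monoʳ-≤ (suc (size s)) l≤) (≤-trans n≤ (m≤n+m _ _))
ifᴾ {b} B F G .run s | _ ∙ _ | l , r , l≤ with F .run s
...   | n , r′ , n≤ = _ , run-if-true r r′ ,
        +-mono-≤ (+-monoʳ-≤ (suc (size s)) l≤) (≤-trans n≤ (m≤m+n _ _))

_≟ᵗ_ : (s t : Tree) → Dec (s ≡ t)
nil     ≟ᵗ nil       = yes refl
nil     ≟ᵗ (_ ∙ _)   = no λ ()
(_ ∙ _) ≟ᵗ nil       = no λ ()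
(s ∙ t) ≟ᵗ (s′ ∙ t′) =
  map′ (λ (p , q) → cong₂ _∙_ p q) (λ { refl → refl , refl }) ((s ≟ᵗ s′) ×-dec (t ≟ᵗ t′))

eqᵗ : Tree → Tree → Tree
eqᵗ s t with s ≟ᵗ t
... | yes _ = nil ∙ nil
... | no _  = nil

eqᴾ : ∀ {f g} → PolyTime f → PolyTime g → PolyTime (λ s → eqᵗ (f s) (g s))
eqᴾ {f} {g} F G = (F ∙ᴾ G) ⟫ onPairs
  where
  onPair : Tree → Tree
  onPair nil     = nil
  onPair (s ∙ t) = eqᵗ s t

  onPairs : PolyTime onPair
  onPairs .program = `eq
  onPairs .time    = con 1 ⊕ var
  onPairs .run nil = _ , run-eq-nil , ≤-refl
  onPairs .run (s ∙ t) with s ≟ᵗ t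
  ... | yes refl = _ , run-eq-true , ≤-refl
  ... | no s≢t   = _ , run-eq-false s≢t , ≤-refl

-- Loops

foldlᵗ foldrᵗ : (Tree → Tree → Tree) → Tree → Tree → Tree
foldlᵗ g a nil     = a
foldlᵗ g a (h ∙ t) = foldlᵗ g (g h a) t
foldrᵗ g z nil     = z
foldrᵗ g z (h ∙ t) = g h (foldrᵗ g z t)

-- Each round of the loop is charged for its whole state, so all accumulators have to be bounded and
-- not only the last one.
data PartialResults≤ (B : ℕ) (g : Tree → Tree → Tree) : Tree → Tree → Set where
  done : ∀ {a} → size a ≤ B → PartialResults≤ B g a nil
  more : ∀ {a h t} → size a ≤ B → PartialResults≤ B g (g h a) t → PartialResults≤ B g a (h ∙ t)

module _ {g : Tree → Tree → Tree → Tree}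
         (G : PolyTime (λ s → g (hd s) (hd (tl s)) (tl (tl s)))) where

  private
    rest : PolyTime (λ s → tl (tl s))
    rest = tlᴾ ⟫ tlᴾ

    body : PolyTime (λ s → hd s ∙ (g (hd s) (hd (tl (tl s))) (hd (tl s)) ∙ tl (tl (tl s))))
    body = hdᴾ ∙ᴾ ((hdᴾ ∙ᴾ ((rest ⟫ hdᴾ) ∙ᴾ (tlᴾ ⟫ hdᴾ))) ⟫ G) ∙ᴾ (rest ⟫ tlᴾ)

    round : Poly
    round = (con 1 ⊕ var) ⊕ rest .time ⊕ body .time

    while : Program
    while = `while (rest .program) (body .program)

    -- The state is parameter, accumulator and remaining list; `M` bounds its size throughout. The
    -- factor `size l` pays for one round per entry and, since `size nil` is 1, for the final test.
    loop : ∀ {B M} c a l → PartialResults≤ B (g c) a l → suc (size c + suc (B + size l)) ≤ M →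
           ∃[ n ] (Run while (c ∙ a ∙ l) (c ∙ foldlᵗ (g c) a l ∙ nil) n × n ≤ size l * eval round M)
    loop {B} {M} c a nil (done a≤B) ≤M with rest .run (c ∙ a ∙ nil)
    ... | m , r , m≤ = _ , run-stop r , (begin
      suc (size s) + m                         ≤⟨ +-mono-≤ (s≤s s≤M) (≤-trans m≤ (eval-mono (rest .time) s≤M)) ⟩
      suc M + eval (rest .time) M              ≤⟨ m≤m+n _ _ ⟩
      eval round M                             ≡⟨ *-identityˡ _ ⟨
      1 * eval round M                         ∎)
      where
      open ≤-Reasoning
      s = c ∙ a ∙ nil
      s≤M : size s ≤ M
      s≤M = ≤-trans (s≤s (+-monoʳ-≤ (size c) (s≤s (+-monoˡ-≤ 1 a≤B)))) ≤M
    loop {B} {M} c a (h ∙ t) (more a≤B results) ≤M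
      with rest .run (c ∙ a ∙ h ∙ t) | body .run (c ∙ a ∙ h ∙ t)
         | loop c (g c h a) t results
             (≤-trans (s≤s (+-monoʳ-≤ (size c) (s≤s (+-monoʳ-≤ B (size-tl (h ∙ t)))))) ≤M)
    ... | l , r , l≤ | m , r′ , m≤ | n , r″ , n≤ = _ , run-loop r r′ r″ , (begin
      suc (size s) + l + m + n                    ≤⟨ +-mono-≤ (+-mono-≤ (+-mono-≤ (s≤s s≤M)
                                                       (≤-trans l≤ (eval-mono (rest .time) s≤M)))
                                                       (≤-trans m≤ (eval-mono (body .time) s≤M))) n≤ ⟩
      eval round M + size t * eval round M        ≤⟨ +-monoʳ-≤ (eval round M)
                                                       (*-monoˡ-≤ (eval round M) (m≤n+m (size t) (size h))) ⟩
      suc (size h + size t) * eval round M        ∎)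
      where
      open ≤-Reasoning
      s = c ∙ a ∙ h ∙ t
      s≤M : size s ≤ M
      s≤M = ≤-trans (s≤s (+-monoʳ-≤ (size c) (s≤s (+-monoˡ-≤ (size (h ∙ t)) a≤B)))) ≤M

    -- An arbitrary input may be too small to have three components; rebuilding it yields the shape
    -- `c ∙ a ∙ l` that `loop` works on.
    normalize : PolyTime (λ s → hd s ∙ hd (tl s) ∙ tl (tl s))
    normalize = hdᴾ ∙ᴾ (tlᴾ ⟫ hdᴾ) ∙ᴾ rest

  foldlᴾ : (r : Poly) →
           (∀ c a l → PartialResults≤ (eval r (size (c ∙ a ∙ l))) (g c) a l) →
           PolyTime (λ s → foldlᵗ (g (hd s)) (hd (tl s)) (tl (tl s)))
  foldlᴾ r bounded = record { program = normalize .program ⨾ while ⨾ `tl ⨾ `hd ; time = total ; run = runs }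
    where
    T M loops total : Poly
    T     = normalize .time
    M     = T ⊕ substitute r T
    loops = T ⊗ substitute round M
    total = T ⊕ (loops ⊕ ((con 1 ⊕ loops) ⊕ (con 1 ⊕ loops)))

    runs : ∀ s → _
    runs s with normalize .run s
           | loop (hd s) (hd (tl s)) (tl (tl s)) (bounded (hd s) (hd (tl s)) (tl (tl s))) ≤-refl
    ... | l , run₀ , l≤ | m , run₁ , m≤ =
      _ , run-seq run₀ (run-seq run₁ (run-seq run-tl run-hd)) ,
      +-mono-≤ l≤ (+-mono-≤ m≤loops (+-mono-≤ (s≤s out≤) (s≤s (≤-trans (size-tl out) out≤))))
      where
      open ≤-Reasoning
      c = hd s
      a = hd (tl s)
      xs = tl (tl s)
      out : Tree
      out = c ∙ foldlᵗ (g c) a xs ∙ nil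
      B : ℕ
      B = eval r (size (c ∙ a ∙ xs))
      u≤T : size (c ∙ a ∙ xs) ≤ eval T (size s)
      u≤T = size-bound normalize s
      xs≤T : size xs ≤ eval T (size s)
      xs≤T = ≤-trans (size-tl (a ∙ xs)) (≤-trans (size-tl (c ∙ a ∙ xs)) u≤T)
      ≤M : suc (size c + suc (B + size xs)) ≤ eval M (size s)
      ≤M = begin
        suc (size c + suc (B + size xs))
          ≤⟨ s≤s (+-monoʳ-≤ (size c) (s≤s (+-monoʳ-≤ B (m≤n+m (size xs) (size a))))) ⟩
        suc (size c + suc (B + (size a + size xs)))
          ≡⟨ rearrange (size c) B (size a + size xs) ⟩
        size (c ∙ a ∙ xs) + B
          ≤⟨ +-mono-≤ u≤T (≤-trans (eval-mono r u≤T) (≤-reflexive (sym (eval-substitute r T (size s))))) ⟩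
        eval M (size s) ∎
        where
        rearrange : ∀ x y z → suc (x + suc (y + z)) ≡ suc (x + suc z) + y
        rearrange = solve-∀
      m≤loops : m ≤ eval loops (size s)
      m≤loops = ≤-trans m≤ (*-mono-≤ xs≤T (≤-trans (eval-mono round ≤M)
                  (≤-reflexive (sym (eval-substitute round M (size s))))))
      out≤ : size out ≤ eval loops (size s)
      out≤ = ≤-trans (size-result≤time run₁) m≤loops

push-size : ∀ x y z → suc (x + y) + z ≡ y + suc (x + z)
push-size = solve-∀

revAppᵗ : Tree → Tree → Tree
revAppᵗ l a = foldlᵗ _∙_ a l

revAppᴾ : PolyTime (λ s → revAppᵗ (tl s) (hd s))
revAppᴾ = (nilᴾ ∙ᴾ hdᴾ ∙ᴾ tlᴾ) ⟫ foldlᴾ {g = λ _ → _∙_} ((tlᴾ ⟫ hdᴾ) ∙ᴾ (tlᴾ ⟫ tlᴾ)) var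
            (λ c a l → weaken (m≤n⇒m≤1+n (≤-trans (n≤1+n _) (m≤n+m _ (size c)))) (partial a l))
  where
  weaken : ∀ {g B B′ a l} → B ≤ B′ → PartialResults≤ B g a l → PartialResults≤ B′ g a l
  weaken B≤B′ (done a≤)   = done (≤-trans a≤ B≤B′)
  weaken B≤B′ (more a≤ p) = more (≤-trans a≤ B≤B′) (weaken B≤B′ p)

  partial : ∀ a l → PartialResults≤ (size a + size l) _∙_ a l
  partial a nil     = done (m≤m+n _ _)
  partial a (h ∙ t) = more (m≤m+n _ _)
    (subst (λ B → PartialResults≤ B _∙_ (h ∙ a) t) (push-size (size h) (size a) (size t)) (partial (h ∙ a) t))

foldl-revApp : ∀ g z l a → foldlᵗ g z (revAppᵗ l a) ≡ foldlᵗ g (foldrᵗ g z l) a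
foldl-revApp g z nil     a = refl
foldl-revApp g z (h ∙ t) a = foldl-revApp g z t (h ∙ a)

-- A right fold is a left fold over the reversed list. Its accumulators are the folds of the
-- suffixes, so a bound on final results, assumed for all lists, already bounds every intermediate
-- one.
foldrᴾ : ∀ {g : Tree → Tree → Tree → Tree} →
         PolyTime (λ s → g (hd s) (hd (tl s)) (tl (tl s))) → (r : Poly) →
         (∀ c z l → size (foldrᵗ (g c) z l) ≤ eval r (size (c ∙ z ∙ l))) →
         PolyTime (λ s → foldrᵗ (g (hd s)) (hd (tl s)) (tl (tl s)))
foldrᴾ {g} G r bounded = extensional
  (λ s → foldl-revApp (g (hd s)) (hd (tl s)) (tl (tl s)) nil)
  ((hdᴾ ∙ᴾ (tlᴾ ⟫ hdᴾ) ∙ᴾ ((nilᴾ ∙ᴾ (tlᴾ ⟫ tlᴾ)) ⟫ revAppᴾ)) ⟫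
   -- The `con 1` is the size of `nil`, the initially empty list of processed entries.
   foldlᴾ {g = g} G (substitute r (con 1 ⊕ var)) partial)
  where
  -- Here `p` is the suffix already folded and `l` the reversed rest. Moving an entry from `l` to
  -- `p` keeps the sum of their sizes, so the bound is the same in all rounds.
  results : ∀ c z p l → PartialResults≤ (eval r (suc (size c + suc (size z + (size p + size l)))))
                                        (g c) (foldrᵗ (g c) z p) l
  bound : ∀ c z p l → size (foldrᵗ (g c) z p) ≤ eval r (suc (size c + suc (size z + (size p + size l))))
  bound c z p l = ≤-trans (bounded c z p)
    (eval-mono r (s≤s (+-monoʳ-≤ (size c) (s≤s (+-monoʳ-≤ (size z) (m≤m+n (size p) (size l)))))))
  results c z p nil     = done (bound c z p nil)
  results c z p (h ∙ t) = more (bound c z p (h ∙ t))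
    (subst (λ n → PartialResults≤ (eval r (suc (size c + suc (size z + n)))) (g c) (foldrᵗ (g c) z (h ∙ p)) t)
           (push-size (size h) (size p) (size t)) (results c z (h ∙ p) t))

  partial : ∀ c z l → PartialResults≤ (eval (substitute r (con 1 ⊕ var)) (size (c ∙ z ∙ l))) (g c) z l
  partial c z l = subst (λ B → PartialResults≤ B (g c) z l)
    (trans (cong (eval r) (rearrange (size c) (size z) (size l)))
           (sym (eval-substitute r (con 1 ⊕ var) (size (c ∙ z ∙ l)))))
    (results c z nil l)
    where
    rearrange : ∀ x y z → suc (x + suc (y + (1 + z))) ≡ 1 + suc (x + suc (y + z))
    rearrange = solve-∀


-- List operations on trees

-- The increment may depend on the parameter and the entry but not on the accumulator; increments
-- then add up, whereas growth relative to the accumulator could become exponential.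
additive-bound : ∀ {g : Tree → Tree → Tree → Tree} (p : Poly) →
  (∀ c h a → size (g c h a) ≤ size a + eval p (size c + size h)) →
  ∀ c z l → size (foldrᵗ (g c) z l) ≤ eval (var ⊕ var ⊗ p) (size (c ∙ z ∙ l))
additive-bound {g} p growth c z l = ≤-trans (bound l)
  (+-mono-≤ (≤-trans (m≤m+n (size z) (size l)) z+l≤)
            (*-mono-≤ (≤-trans (m≤n+m (size l) (size z)) z+l≤)
                      (eval-mono p (m≤n⇒m≤1+n (+-monoʳ-≤ (size c) (m≤n⇒m≤1+n (m≤n+m _ _)))))))
  where
  open ≤-Reasoning
  z+l≤ : size z + size l ≤ size (c ∙ z ∙ l)
  z+l≤ = m≤n⇒m≤1+n (≤-trans (n≤1+n _) (m≤n+m _ (size c)))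
  bound : ∀ l → size (foldrᵗ (g c) z l) ≤ size z + size l * eval p (size c + size l)
  bound nil     = m≤m+n _ _
  bound (h ∙ t) = begin
    size (g c h (foldrᵗ (g c) z t))
      ≤⟨ growth c h _ ⟩
    size (foldrᵗ (g c) z t) + eval p (size c + size h)
      ≤⟨ +-mono-≤ (bound t) (eval-mono p (+-monoʳ-≤ (size c) (m≤n⇒m≤1+n (m≤m+n _ _)))) ⟩
    size z + size t * eval p (size c + size t) + eval p (size c + size (h ∙ t))
      ≤⟨ +-monoˡ-≤ _ (+-monoʳ-≤ (size z) (*-mono-≤ (m≤n+m (size t) (size h))
           (eval-mono p (+-monoʳ-≤ (size c) (m≤n⇒m≤1+n (m≤n+m _ _)))))) ⟩
    size z + (size h + size t) * E + E
      ≡⟨ rearrange (size z) (size h + size t) E ⟩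
    size z + suc (size h + size t) * E ∎
    where
    E : ℕ
    E = eval p (size c + size (h ∙ t))
    rearrange : ∀ x y e → x + y * e + e ≡ x + suc y * e
    rearrange = solve-∀

foldrᴾ⁺ : ∀ {g : Tree → Tree → Tree → Tree} →
          PolyTime (λ s → g (hd s) (hd (tl s)) (tl (tl s))) → (p : Poly) →
          (∀ c h a → size (g c h a) ≤ size a + eval p (size c + size h)) →
          PolyTime (λ s → foldrᵗ (g (hd s)) (hd (tl s)) (tl (tl s)))
foldrᴾ⁺ {g} G p growth = foldrᴾ {g = g} G (var ⊕ var ⊗ p) (additive-bound {g} p growth)

size-if : ∀ {B} b s t → size s ≤ B → size t ≤ B → size (ifᵗ b s t) ≤ B
size-if nil     s t s≤ t≤ = t≤
size-if (_ ∙ _) s t s≤ t≤ = s≤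

mapᵗ : (Tree → Tree) → Tree → Tree
mapᵗ f = foldrᵗ (λ h a → f h ∙ a) nil

mapᴾ : ∀ {f : Tree → Tree → Tree} {c l} → PolyTime (λ s → f (hd s) (tl s)) →
       PolyTime c → PolyTime l → PolyTime (λ s → mapᵗ (f (c s)) (l s))
mapᴾ {f} F C L = (C ∙ᴾ nilᴾ ∙ᴾ L) ⟫
  foldrᴾ⁺ {g = λ c h a → f c h ∙ a} (((hdᴾ ∙ᴾ (tlᴾ ⟫ hdᴾ)) ⟫ F) ∙ᴾ (tlᴾ ⟫ tlᴾ)) p growth
  where
  p : Poly
  p = con 1 ⊕ substitute (F .time) (con 1 ⊕ var)
  growth : ∀ c h a → size (f c h ∙ a) ≤ size a + eval p (size c + size h)
  growth c h a = begin
    suc (size (f c h) + size a)                                ≡⟨ +-comm (suc (size (f c h))) (size a) ⟩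
    size a + suc (size (f c h))                                ≤⟨ +-monoʳ-≤ (size a) (s≤s (size-bound F (c ∙ h))) ⟩
    size a + suc (eval (F .time) (suc (size c + size h)))      ≡⟨ cong (λ n → size a + suc n)
                                                                    (eval-substitute (F .time) (con 1 ⊕ var) _) ⟨
    size a + eval p (size c + size h)                          ∎
    where open ≤-Reasoning

-- A hit is wrapped as `h ∙ nil`: vertex 0 is encoded by `nil`, so a bare hit could not be told from
-- failure.
findᵗ : (Tree → Tree) → Tree → Tree
findᵗ p = foldrᵗ (λ h a → ifᵗ (p h) (h ∙ nil) a) nil

findᴾ : ∀ {p : Tree → Tree → Tree} {c l} → PolyTime (λ s → p (hd s) (tl s)) →
        PolyTime c → PolyTime l → PolyTime (λ s → findᵗ (p (c s)) (l s))
findᴾ {p} P C L = (C ∙ᴾ nilᴾ ∙ᴾ L) ⟫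
  foldrᴾ⁺ {g = λ c h a → ifᵗ (p c h) (h ∙ nil) a}
    (ifᴾ ((hdᴾ ∙ᴾ (tlᴾ ⟫ hdᴾ)) ⟫ P) ((tlᴾ ⟫ hdᴾ) ∙ᴾ nilᴾ) (tlᴾ ⟫ tlᴾ)) (con 2 ⊕ var) growth
  where
  growth : ∀ c h a → size (ifᵗ (p c h) (h ∙ nil) a) ≤ size a + (2 + (size c + size h))
  growth c h a = size-if (p c h) (h ∙ nil) a
    (≤-trans (≤-reflexive (cong suc (+-comm (size h) 1)))
      (≤-trans (s≤s (s≤s (m≤n+m (size h) (size c)))) (m≤n+m _ (size a))))
    (m≤m+n _ _)

-- The index is written in unary.
dropᵗ nthᵗ : Tree → Tree → Tree
dropᵗ l i = foldrᵗ (λ _ → tl) l i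
nthᵗ l i  = hd (dropᵗ l i)

nthᴾ : ∀ {l i} → PolyTime l → PolyTime i → PolyTime (λ s → nthᵗ (l s) (i s))
nthᴾ L I = (nilᴾ ∙ᴾ L ∙ᴾ I) ⟫
  foldrᴾ⁺ {g = λ _ _ → tl} (tlᴾ ⟫ tlᴾ ⟫ tlᴾ) (con 0)
    (λ _ _ a → ≤-trans (size-tl a) (m≤m+n _ _)) ⟫ hdᴾ

size-drop : ∀ l i → size (dropᵗ l i) ≤ size l
size-drop l nil     = ≤-refl
size-drop l (_ ∙ i) = ≤-trans (size-tl (dropᵗ l i)) (size-drop l i)

size-nth : ∀ l i → size (nthᵗ l i) ≤ size l
size-nth l i = ≤-trans (size-hd (dropᵗ l i)) (size-drop l i)

concatᵗ : Tree → Tree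
concatᵗ = foldrᵗ (λ w a → foldrᵗ _∙_ a w) nil

concatᴾ : ∀ {l} → PolyTime l → PolyTime (λ s → concatᵗ (l s))
concatᴾ L = (nilᴾ ∙ᴾ nilᴾ ∙ᴾ L) ⟫
  foldrᴾ⁺ {g = λ _ w a → foldrᵗ _∙_ a w}
    ((nilᴾ ∙ᴾ (tlᴾ ⟫ tlᴾ) ∙ᴾ (tlᴾ ⟫ hdᴾ)) ⟫
     foldrᴾ⁺ {g = λ _ → _∙_} ((tlᴾ ⟫ hdᴾ) ∙ᴾ (tlᴾ ⟫ tlᴾ)) (con 1 ⊕ var) step) var
    λ c w a → ≤-trans (append w a) (+-monoʳ-≤ (size a) (m≤n+m (size w) (size c)))
  where
  step : ∀ (c : Tree) h a → suc (size h + size a) ≤ size a + suc (size c + size h)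
  step c h a = ≤-trans (≤-reflexive (+-comm (suc (size h)) (size a)))
                       (+-monoʳ-≤ (size a) (s≤s (m≤n+m _ _)))
  append : ∀ w a → size (foldrᵗ _∙_ a w) ≤ size a + size w
  append nil     a = m≤m+n _ _
  append (h ∙ w) a = begin
    suc (size h + size (foldrᵗ _∙_ a w)) ≤⟨ s≤s (+-monoʳ-≤ (size h) (append w a)) ⟩
    suc (size h + (size a + size w))     ≡⟨ rearrange (size h) (size a) (size w) ⟩
    size a + suc (size h + size w)       ∎
    where
    open ≤-Reasoning
    rearrange : ∀ x y z → suc (x + (y + z)) ≡ y + suc (x + z)
    rearrange = solve-∀

-- The list is only a clock: its entries are ignored and its length is the number of rounds.
iterateᵗ : (Tree → Tree) → Tree → Tree → Tree
iterateᵗ f z l = foldrᵗ (λ _ → f) z l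

lengthᵗ : Tree → ℕ
lengthᵗ nil     = 0
lengthᵗ (h ∙ t) = suc (lengthᵗ t)

indicesᵗ : Tree → Tree
indicesᵗ = iterateᵗ (λ a → nil ∙ mapᵗ (nil ∙_) a) nil

-- Each round puts 0 in front and increments all previous entries, so the increment depends on the
-- accumulator and `foldrᴾ⁺` does not apply. It depends only on the number of entries, though, which
-- grows by one per round.
indicesᴾ : ∀ {l} → PolyTime l → PolyTime (λ s → indicesᵗ (l s))
indicesᴾ L = (nilᴾ ∙ᴾ nilᴾ ∙ᴾ L) ⟫
  foldrᴾ {g = λ _ _ a → push a}
    (nilᴾ ∙ᴾ mapᴾ {f = λ _ h → nil ∙ h} (nilᴾ ∙ᴾ tlᴾ) nilᴾ (tlᴾ ⟫ tlᴾ))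
    (var ⊕ var ⊗ (con 2 ⊕ con 2 ⊗ var)) bound
  where
  push : Tree → Tree
  push a = nil ∙ mapᵗ (nil ∙_) a

  size-map : ∀ a → size (mapᵗ (nil ∙_) a) ≡ size a + 2 * lengthᵗ a
  size-map nil     = refl
  size-map (h ∙ t) = trans (cong (λ n → suc (suc (suc (size h)) + n)) (size-map t))
                           (rearrange (size h) (size t) (lengthᵗ t))
    where
    rearrange : ∀ x y z → suc (suc (suc x) + (y + 2 * z)) ≡ suc (x + y) + 2 * suc z
    rearrange = solve-∀

  length-map : ∀ a → lengthᵗ (mapᵗ (nil ∙_) a) ≡ lengthᵗ a
  length-map nil     = refl
  length-map (h ∙ t) = cong suc (length-map t)

  length≤size : ∀ a → lengthᵗ a ≤ size a
  length≤size nil     = z≤n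
  length≤size (h ∙ t) = s≤s (≤-trans (length≤size t) (m≤n+m _ _))

  length-iterate : ∀ z l → lengthᵗ (iterateᵗ push z l) ≤ size z + size l
  length-iterate z nil     = ≤-trans (length≤size z) (m≤m+n _ _)
  length-iterate z (h ∙ t) = begin
    suc (lengthᵗ (mapᵗ (nil ∙_) (iterateᵗ push z t))) ≡⟨ cong suc (length-map (iterateᵗ push z t)) ⟩
    suc (lengthᵗ (iterateᵗ push z t))                 ≤⟨ s≤s (length-iterate z t) ⟩
    suc (size z + size t)                             ≡⟨ +-suc (size z) (size t) ⟨
    size z + suc (size t)                             ≤⟨ +-monoʳ-≤ (size z) (s≤s (m≤n+m _ _)) ⟩
    size z + size (h ∙ t)                             ∎
    where open ≤-Reasoning

  size-iterate : ∀ N z l → size z + size l ≤ N → size (iterateᵗ push z l) ≤ size z + size l * (2 + 2 * N)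
  size-iterate N z nil     _  = m≤m+n _ _
  size-iterate N z (h ∙ t) ≤N = begin
    2 + size (mapᵗ (nil ∙_) a)                     ≡⟨ cong (2 +_) (size-map a) ⟩
    2 + (size a + 2 * lengthᵗ a)                   ≤⟨ +-monoʳ-≤ 2 (+-mono-≤ (size-iterate N z t zt≤N)
                                                        (*-monoʳ-≤ 2 (≤-trans (length-iterate z t) zt≤N))) ⟩
    2 + (size z + size t * (2 + 2 * N) + 2 * N)    ≡⟨ rearrange (size z) (size t) N ⟩
    size z + suc (size t) * (2 + 2 * N)            ≤⟨ +-monoʳ-≤ (size z) (*-monoˡ-≤ (2 + 2 * N) (s≤s (m≤n+m _ (size h)))) ⟩
    size z + size (h ∙ t) * (2 + 2 * N)            ∎
    where
    open ≤-Reasoning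
    a = iterateᵗ push z t
    zt≤N : size z + size t ≤ N
    zt≤N = ≤-trans (+-monoʳ-≤ (size z) (size-tl (h ∙ t))) ≤N
    rearrange : ∀ x y n → 2 + (x + y * (2 + 2 * n) + 2 * n) ≡ x + suc y * (2 + 2 * n)
    rearrange = solve-∀

  bound : ∀ c z l → size (iterateᵗ push z l) ≤ eval (var ⊕ var ⊗ (con 2 ⊕ con 2 ⊗ var)) (size (c ∙ z ∙ l))
  bound c z l = ≤-trans (size-iterate (size (c ∙ z ∙ l)) z l z+l≤)
    (+-mono-≤ (≤-trans (m≤m+n _ _) z+l≤)
      (*-monoˡ-≤ (2 + 2 * size (c ∙ z ∙ l)) (≤-trans (m≤n+m _ (size z)) z+l≤)))
    where
    z+l≤ : size z + size l ≤ size (c ∙ z ∙ l)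
    z+l≤ = m≤n⇒m≤1+n (≤-trans (n≤1+n _) (m≤n+m _ (size c)))

size-map : ∀ {B} f l → (∀ x → size (f x) ≤ B) → size (mapᵗ f l) ≤ size l * suc B
size-map f nil     f≤ = s≤s z≤n
size-map {B} f (h ∙ t) f≤ = s≤s (+-mono-≤ (f≤ h)
  (≤-trans (size-map f t f≤) (*-monoˡ-≤ (suc B) (m≤n+m (size t) (size h)))))

-- An index beyond the end yields `nil`, of size 1; hence the hypothesis `1 ≤ B`.
size-map-nth : ∀ {B} f l → (∀ x → size (f x) ≤ B) → 1 ≤ B → ∀ i → size (nthᵗ (mapᵗ f l) i) ≤ B
size-map-nth {B} f l f≤ 1≤B i with dropᵗ (mapᵗ f l) i | drop-map i
  where
  tl-map : ∀ l → tl (mapᵗ f l) ≡ mapᵗ f (tl l)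
  tl-map nil     = refl
  tl-map (h ∙ t) = refl
  drop-map : ∀ i → ∃[ l′ ] dropᵗ (mapᵗ f l) i ≡ mapᵗ f l′
  drop-map nil     = l , refl
  drop-map (_ ∙ i) with drop-map i
  ... | l′ , eq = tl l′ , trans (cong tl eq) (tl-map l′)
... | _ | nil     , refl = 1≤B
... | _ | (h ∙ t) , refl = f≤ h

-- The recoloring program

module Algorithm where

  revᵗ : Tree → Tree
  revᵗ w = revAppᵗ w nil

  revᴾ : ∀ {l} → PolyTime l → PolyTime (λ s → revᵗ (l s))
  revᴾ L = (nilᴾ ∙ᴾ L) ⟫ revAppᴾ

  -- Since hd nil = nil encodes the vertex 0, the test of tl w is not redundant.
  consᵗ : Tree → Tree → Tree
  consᵗ a w = ifᵗ (tl w) (ifᵗ (eqᵗ (hd (tl w)) a) (tl w) (a ∙ w)) (a ∙ w)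

  consᴾ : ∀ {a w} → PolyTime a → PolyTime w → PolyTime (λ s → consᵗ (a s) (w s))
  consᴾ A W = ifᴾ (W ⟫ tlᴾ) (ifᴾ (eqᴾ (W ⟫ tlᴾ ⟫ hdᴾ) A) (W ⟫ tlᴾ) (A ∙ᴾ W)) (A ∙ᴾ W)

  -- This adds an edge at both ends of a reduced walk, with cancellation; the far end is reached by
  -- reversing twice.
  extendᵗ : Tree → Tree → Tree → Tree
  extendᵗ a b w = revᵗ (consᵗ b (revᵗ (consᵗ a w)))

  extendᴾ : ∀ {a b w} → PolyTime a → PolyTime b → PolyTime w → PolyTime (λ s → extendᵗ (a s) (b s) (w s))
  extendᴾ A B W = revᴾ (consᴾ B (revᴾ (consᴾ A W)))

  -- A table lists, for each vertex, the vertex list of its walk, or nil if this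
  -- walk is not known yet.
  initialᵗ : Tree → Tree → Tree → Tree → Tree
  initialᵗ I α q Q = mapᵗ (λ v → ifᵗ (eqᵗ v q) (nthᵗ α v ∙ mapᵗ tl Q) nil) I

  initialᴾ : ∀ {I α q Q} → PolyTime I → PolyTime α → PolyTime q → PolyTime Q →
             PolyTime (λ s → initialᵗ (I s) (α s) (q s) (Q s))
  initialᴾ I A q Q = mapᴾ {f = λ c v → ifᵗ (eqᵗ v (hd (tl c))) (nthᵗ (hd c) v ∙ mapᵗ tl (tl (tl c))) nil}
    (ifᴾ (eqᴾ tlᴾ (hdᴾ ⟫ tlᴾ ⟫ hdᴾ))
         (nthᴾ (hdᴾ ⟫ hdᴾ) tlᴾ ∙ᴾ mapᴾ {f = λ _ → tl} (tlᴾ ⟫ tlᴾ) nilᴾ (hdᴾ ⟫ tlᴾ ⟫ tlᴾ))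
         nilᴾ)
    (A ∙ᴾ q ∙ᴾ Q) I

  -- The entry of `v` serves as the truth value: the vertex list of a walk contains at least its
  -- starting vertex and is never `nil`.
  knownNeighborᵗ : Tree → Tree → Tree → Tree → Tree
  knownNeighborᵗ E T u v = ifᵗ (nthᵗ (nthᵗ E u) v) (nthᵗ T v) nil

  entryᵗ : Tree → Tree → Tree → Tree → Tree → Tree
  entryᵗ α β T u v = ifᵗ v (extendᵗ (nthᵗ α u) (nthᵗ β u) (nthᵗ T (hd v))) nil

  expandᵗ : Tree → Tree → Tree → Tree → Tree → Tree
  expandᵗ I E α β T = mapᵗ (λ u → ifᵗ (nthᵗ T u) (nthᵗ T u)
    (entryᵗ α β T u (findᵗ (knownNeighborᵗ E T u) I))) I

  expandᴾ : PolyTime (λ s → expandᵗ (hd (hd s)) (hd (tl (hd s))) (hd (tl (tl (hd s)))) (tl (tl (tl (hd s)))) (tl s))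
  expandᴾ = mapᴾ {f = λ c u → ifᵗ (nthᵗ (tl c) u) (nthᵗ (tl c) u)
                     (entryᵗ (hd (tl (tl (hd c)))) (tl (tl (tl (hd c)))) (tl c) u
                       (findᵗ (knownNeighborᵗ (hd (tl (hd c))) (tl c) u) (hd (hd c))))}
    (ifᴾ (nthᴾ T u) (nthᴾ T u)
      (ifᴾ find (extendᴾ (nthᴾ (hdᴾ ⟫ hdᴾ ⟫ tlᴾ ⟫ tlᴾ ⟫ hdᴾ) u) (nthᴾ (hdᴾ ⟫ hdᴾ ⟫ tlᴾ ⟫ tlᴾ ⟫ tlᴾ) u)
                         (nthᴾ T (find ⟫ hdᴾ))) nilᴾ))
    idᴾ (hdᴾ ⟫ hdᴾ)
    where
    T : PolyTime (λ s → tl (hd s))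
    T = hdᴾ ⟫ tlᴾ
    u : PolyTime tl
    u = tlᴾ
    E : PolyTime (λ s → hd (tl (hd (hd s))))
    E = hdᴾ ⟫ hdᴾ ⟫ tlᴾ ⟫ hdᴾ
    find : PolyTime (λ s → findᵗ (knownNeighborᵗ (hd (tl (hd (hd s)))) (tl (hd s)) (tl s)) (hd (hd (hd s))))
    find = findᴾ {p = λ c v → knownNeighborᵗ (hd c) (hd (tl c)) (tl (tl c)) v}
      (ifᴾ (nthᴾ (nthᴾ (hdᴾ ⟫ hdᴾ) (hdᴾ ⟫ tlᴾ ⟫ tlᴾ)) tlᴾ) (nthᴾ (hdᴾ ⟫ tlᴾ ⟫ hdᴾ) tlᴾ) nilᴾ)
      (E ∙ᴾ T ∙ᴾ u) (hdᴾ ⟫ hdᴾ ⟫ hdᴾ)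

  size-revApp : ∀ l a → suc (size (revAppᵗ l a)) ≡ size a + size l
  size-revApp nil     a = +-comm 1 (size a)
  size-revApp (h ∙ t) a = trans (size-revApp t (h ∙ a)) (push-size (size h) (size a) (size t))

  size-rev : ∀ l → size (revᵗ l) ≡ size l
  size-rev l = suc-injective (size-revApp l nil)

  size-cons : ∀ a w → size (consᵗ a w) ≤ suc (size a + size w)
  size-cons a w = size-if (tl w) _ _
    (size-if (eqᵗ (hd (tl w)) a) _ _ (m≤n⇒m≤1+n (≤-trans (size-tl w) (m≤n+m _ _))) ≤-refl) ≤-refl

  size-extend : ∀ a b w → size (extendᵗ a b w) ≤ size w + (2 + (size a + size b))
  size-extend a b w = begin
    size (extendᵗ a b w)                          ≡⟨ size-rev (consᵗ b (revᵗ (consᵗ a w))) ⟩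
    size (consᵗ b (revᵗ (consᵗ a w)))             ≤⟨ size-cons b (revᵗ (consᵗ a w)) ⟩
    suc (size b + size (revᵗ (consᵗ a w)))        ≡⟨ cong (λ n → suc (size b + n)) (size-rev (consᵗ a w)) ⟩
    suc (size b + size (consᵗ a w))               ≤⟨ s≤s (+-monoʳ-≤ (size b) (size-cons a w)) ⟩
    suc (size b + suc (size a + size w))          ≡⟨ rearrange (size a) (size b) (size w) ⟩
    size w + (2 + (size a + size b))              ∎
    where
    open ≤-Reasoning
    rearrange : ∀ x y z → suc (y + suc (x + z)) ≡ z + (2 + (x + y))
    rearrange = solve-∀

  module _ (I E α β : Tree) where

    size-entry : ∀ {B} T → 1 ≤ B → (∀ v → size (nthᵗ T v) ≤ B) → ∀ u v →
                 size (entryᵗ α β T u v) ≤ B + (2 + (size α + size β))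
    size-entry T 1≤B T≤ u v = size-if v _ _
      (≤-trans (size-extend (nthᵗ α u) (nthᵗ β u) (nthᵗ T (hd v)))
        (+-mono-≤ (T≤ (hd v)) (+-monoʳ-≤ 2 (+-mono-≤ (size-nth α u) (size-nth β u)))))
      (≤-trans 1≤B (m≤m+n _ _))

    private
      D : ℕ
      D = 2 + (size α + size β)

      size-new-entry : ∀ {B} T → 1 ≤ B → (∀ v → size (nthᵗ T v) ≤ B) → ∀ u →
        size (ifᵗ (nthᵗ T u) (nthᵗ T u) (entryᵗ α β T u (findᵗ (knownNeighborᵗ E T u) I))) ≤ B + D
      size-new-entry T 1≤B T≤ u = size-if (nthᵗ T u) _ _ (≤-trans (T≤ u) (m≤m+n _ _))
                                    (size-entry T 1≤B T≤ u (findᵗ (knownNeighborᵗ E T u) I))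

      accumulate : ∀ z h t → size z + t * D + D ≤ size z + suc (h + t) * D
      accumulate z h t = begin
        size z + t * D + D       ≡⟨ +-assoc (size z) (t * D) D ⟩
        size z + (t * D + D)     ≡⟨ cong (size z +_) (+-comm (t * D) D) ⟩
        size z + suc t * D       ≤⟨ +-monoʳ-≤ (size z) (*-monoˡ-≤ D (s≤s (m≤n+m t h))) ⟩
        size z + suc (h + t) * D ∎
        where open ≤-Reasoning

    -- The bound is kept entry by entry. Many new entries may be built from the same old one, so
    -- comparing whole tables would only give a factor per round, while a single entry grows by a
    -- constant amount `D`.
    size-iterate-expand-nth : ∀ z l i → size (nthᵗ (iterateᵗ (expandᵗ I E α β) z l) i) ≤ size z + size l * D
    size-iterate-expand-nth z nil i = ≤-trans (size-nth z i) (m≤m+n _ _)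
    size-iterate-expand-nth z (h ∙ t) i = ≤-trans
      (size-map-nth _ I (size-new-entry T (≤-trans (1≤size z) (m≤m+n _ _)) (size-iterate-expand-nth z t))
        (≤-trans (1≤size z) (≤-trans (m≤m+n _ (size t * D)) (m≤m+n _ D))) i)
      (accumulate z (size h) (size t))
      where
      T = iterateᵗ (expandᵗ I E α β) z t

    size-iterate-expand : ∀ z l → size (iterateᵗ (expandᵗ I E α β) z l) ≤ size z + size I * suc (size z + size l * D)
    size-iterate-expand z nil     = m≤m+n _ _
    size-iterate-expand z (h ∙ t) = ≤-trans
      (size-map _ I (size-new-entry T (≤-trans (1≤size z) (m≤m+n _ _)) (size-iterate-expand-nth z t)))
      (≤-trans (*-monoʳ-≤ (size I) (s≤s (accumulate z (size h) (size t)))) (m≤n+m _ (size z)))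
      where
      T = iterateᵗ (expandᵗ I E α β) z t

  iterateExpandᴾ : PolyTime (λ s → iterateᵗ
    (expandᵗ (hd (hd s)) (hd (tl (hd s))) (hd (tl (tl (hd s)))) (tl (tl (tl (hd s))))) (hd (tl s)) (tl (tl s)))
  iterateExpandᴾ = foldrᴾ
    {g = λ c _ T → expandᵗ (hd c) (hd (tl c)) (hd (tl (tl c))) (tl (tl (tl c))) T}
    ((hdᴾ ∙ᴾ (tlᴾ ⟫ tlᴾ)) ⟫ expandᴾ)
    (var ⊕ var ⊗ (con 1 ⊕ (var ⊕ var ⊗ (con 2 ⊕ (var ⊕ var)))))
    λ c z l → ≤-trans (size-iterate-expand (hd c) (hd (tl c)) (hd (tl (tl c))) (tl (tl (tl c))) z l)
      (+-mono-≤ (z≤ c z l) (*-mono-≤ (≤-trans (size-hd c) (c≤ c z l))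
        (s≤s (+-mono-≤ (z≤ c z l) (*-mono-≤ (l≤ c z l) (+-monoʳ-≤ 2 (+-mono-≤
          (≤-trans (size-hd (tl (tl c))) (≤-trans (size-tl (tl c)) (≤-trans (size-tl c) (c≤ c z l))))
          (≤-trans (size-tl (tl (tl c))) (≤-trans (size-tl (tl c)) (≤-trans (size-tl c) (c≤ c z l)))))))))))
    where
    c≤ : ∀ c z l → size c ≤ size (c ∙ z ∙ l)
    c≤ c z l = size-hd (c ∙ z ∙ l)
    z≤ : ∀ c z l → size z ≤ size (c ∙ z ∙ l)
    z≤ c z l = ≤-trans (size-hd (z ∙ l)) (size-tl (c ∙ z ∙ l))
    l≤ : ∀ c z l → size l ≤ size (c ∙ z ∙ l)
    l≤ c z l = ≤-trans (size-tl (z ∙ l)) (size-tl (c ∙ z ∙ l))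

  -- The current coloring is not stored separately: the color of `u` is the first vertex of the walk
  -- that `u` has yet to perform.
  blockingᵗ : Tree → Tree → Tree → Tree → Tree
  blockingᵗ E T v u = ifᵗ (nthᵗ (nthᵗ E v) u)
    (ifᵗ (eqᵗ (hd (nthᵗ T u)) (hd (tl (nthᵗ T v)))) nil (nil ∙ nil)) nil

  readyᵗ : Tree → Tree → Tree → Tree → Tree
  readyᵗ I E T v = ifᵗ (tl (nthᵗ T v)) (ifᵗ (findᵗ (blockingᵗ E T v) I) nil (nil ∙ nil)) nil

  readyᴾ : PolyTime (λ s → readyᵗ (hd (hd (hd s))) (tl (hd (hd s))) (tl (hd s)) (tl s))
  readyᴾ = ifᴾ (nthᴾ (hdᴾ ⟫ tlᴾ) tlᴾ ⟫ tlᴾ)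
    (ifᴾ (findᴾ {p = λ c u → blockingᵗ (hd c) (hd (tl c)) (tl (tl c)) u}
           (ifᴾ (nthᴾ (nthᴾ (hdᴾ ⟫ hdᴾ) (hdᴾ ⟫ tlᴾ ⟫ tlᴾ)) tlᴾ)
             (ifᴾ (eqᴾ (nthᴾ (hdᴾ ⟫ tlᴾ ⟫ hdᴾ) tlᴾ ⟫ hdᴾ) (nthᴾ (hdᴾ ⟫ tlᴾ ⟫ hdᴾ) (hdᴾ ⟫ tlᴾ ⟫ tlᴾ) ⟫ tlᴾ ⟫ hdᴾ))
               nilᴾ (nilᴾ ∙ᴾ nilᴾ))
             nilᴾ)
           ((hdᴾ ⟫ hdᴾ ⟫ tlᴾ) ∙ᴾ (hdᴾ ⟫ tlᴾ) ∙ᴾ tlᴾ) (hdᴾ ⟫ hdᴾ ⟫ hdᴾ))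
      nilᴾ (nilᴾ ∙ᴾ nilᴾ))
    nilᴾ

  shiftᵗ : Tree → Tree → Tree → Tree
  shiftᵗ T w v = ifᵗ (eqᵗ v w) (tl (tl (nthᵗ T v))) (nthᵗ T v)

  -- The state is a table of walks and the list of all previous colorings,
  -- the latest one first.
  stepᵗ : Tree → Tree → Tree → Tree
  stepᵗ I E s = ifᵗ w (mapᵗ (shiftᵗ (hd s) (hd w)) I ∙ mapᵗ hd (hd s) ∙ tl s) s
    where w = findᵗ (readyᵗ I E (hd s)) I

  stepᴾ : PolyTime (λ s → stepᵗ (hd (hd s)) (tl (hd s)) (tl s))
  stepᴾ = ifᴾ w
    (mapᴾ {f = λ c → shiftᵗ (hd c) (tl c)}
       (ifᴾ (eqᴾ tlᴾ (hdᴾ ⟫ tlᴾ)) (nthᴾ (hdᴾ ⟫ hdᴾ) tlᴾ ⟫ tlᴾ ⟫ tlᴾ) (nthᴾ (hdᴾ ⟫ hdᴾ) tlᴾ))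
       ((tlᴾ ⟫ hdᴾ) ∙ᴾ (w ⟫ hdᴾ)) (hdᴾ ⟫ hdᴾ)
     ∙ᴾ mapᴾ {f = λ _ → hd} (tlᴾ ⟫ hdᴾ) nilᴾ (tlᴾ ⟫ hdᴾ) ∙ᴾ (tlᴾ ⟫ tlᴾ))
    tlᴾ
    where
    w : PolyTime (λ s → findᵗ (readyᵗ (hd (hd s)) (tl (hd s)) (hd (tl s))) (hd (hd s)))
    w = findᴾ {p = λ c → readyᵗ (hd (hd c)) (tl (hd c)) (tl c)} readyᴾ
          (hdᴾ ∙ᴾ (tlᴾ ⟫ hdᴾ)) (hdᴾ ⟫ hdᴾ)

  module _ (I E : Tree) where

    private
      table : ℕ → ℕ
      table B = B + size I * suc B

      -- Steps only shorten entries, so the initial state bounds each entry for good. This bounds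
      -- every table, and with it every coloring that a round adds to the log.
      record Sizes (z l s : Tree) : Set where
        field
          nth≤  : ∀ i → size (nthᵗ (hd s) i) ≤ size z
          hd≤   : size (hd s) ≤ table (size z)
          tl≤   : size (tl s) ≤ size z + size l * suc (table (size z))
      open Sizes

      size-map-hd : ∀ T → size (mapᵗ hd T) ≤ size T
      size-map-hd nil     = ≤-refl
      size-map-hd (h ∙ t) = s≤s (+-mono-≤ (size-hd h) (size-map-hd t))

      size-step : ∀ z h t s → Sizes z t s → Sizes z (h ∙ t) (stepᵗ I E s)
      size-step z h t s S with findᵗ (readyᵗ I E (hd s)) I
      ... | nil = record { nth≤ = nth≤ S ; hd≤ = hd≤ S ; tl≤ = ≤-trans (tl≤ S)
              (+-monoʳ-≤ (size z) (*-monoˡ-≤ (suc (table (size z))) (m≤n⇒m≤1+n (m≤n+m (size t) (size h))))) }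
      ... | w ∙ _ = record
        { nth≤ = size-map-nth (shiftᵗ (hd s) w) I shift≤ (1≤size z)
        ; hd≤  = ≤-trans (size-map (shiftᵗ (hd s) w) I shift≤) (m≤n+m _ _)
        ; tl≤  = begin
            suc (size (mapᵗ hd (hd s)) + size (tl s))
              ≤⟨ s≤s (+-mono-≤ (≤-trans (size-map-hd (hd s)) (hd≤ S)) (tl≤ S)) ⟩
            suc (K + (size z + size t * suc K))
              ≡⟨ rearrange (size z) (size t) K ⟩
            size z + suc (size t) * suc K
              ≤⟨ +-monoʳ-≤ (size z) (*-monoˡ-≤ (suc K) (s≤s (m≤n+m (size t) (size h)))) ⟩
            size z + size (h ∙ t) * suc K ∎
        }
        where
        open ≤-Reasoning
        K : ℕ
        K = table (size z)
        rearrange : ∀ x y k → suc (k + (x + y * suc k)) ≡ x + suc y * suc k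
        rearrange = solve-∀
        shift≤ : ∀ v → size (shiftᵗ (hd s) w v) ≤ size z
        shift≤ v = size-if (eqᵗ v w) _ _
          (≤-trans (size-tl (tl (nthᵗ (hd s) v))) (≤-trans (size-tl (nthᵗ (hd s) v)) (nth≤ S v))) (nth≤ S v)

      sizes : ∀ z l → Sizes z l (iterateᵗ (stepᵗ I E) z l)
      sizes z nil = record
        { nth≤ = λ i → ≤-trans (size-nth (hd z) i) (size-hd z)
        ; hd≤  = ≤-trans (size-hd z) (m≤m+n _ _)
        ; tl≤  = ≤-trans (size-tl z) (m≤m+n _ _) }
      sizes z (h ∙ t) = size-step z h t (iterateᵗ (stepᵗ I E) z t) (sizes z t)

    size-iterate-step : ∀ z l → size (iterateᵗ (stepᵗ I E) z l) ≤
      1 + (size z + size I * suc (size z) + (size z + size l * suc (size z + size I * suc (size z))))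
    size-iterate-step z l = ≤-trans (split s) (s≤s (+-mono-≤ (hd≤ (sizes z l)) (tl≤ (sizes z l))))
      where
      s = iterateᵗ (stepᵗ I E) z l
      split : ∀ s → size s ≤ suc (size (hd s) + size (tl s))
      split nil     = s≤s z≤n
      split (h ∙ t) = ≤-refl

  iterateStepᴾ : PolyTime (λ s → iterateᵗ (stepᵗ (hd (hd s)) (tl (hd s))) (hd (tl s)) (tl (tl s)))
  iterateStepᴾ = foldrᴾ {g = λ c _ s → stepᵗ (hd c) (tl c) s} ((hdᴾ ∙ᴾ (tlᴾ ⟫ tlᴾ)) ⟫ stepᴾ)
    (con 1 ⊕ (K ⊕ (var ⊕ var ⊗ (con 1 ⊕ K))))
    λ c z l → let n    = size (c ∙ z ∙ l)
                  z≤   = ≤-trans (size-hd (z ∙ l)) (size-tl (c ∙ z ∙ l))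
                  l≤   = ≤-trans (size-tl (z ∙ l)) (size-tl (c ∙ z ∙ l))
                  K≤   = +-mono-≤ z≤ (*-mono-≤ (≤-trans (size-hd c) (size-hd (c ∙ z ∙ l))) (s≤s z≤))
              in ≤-trans (size-iterate-step (hd c) (tl c) z l)
                   (s≤s (+-mono-≤ K≤ (+-mono-≤ z≤ (*-mono-≤ l≤ (s≤s K≤)))))
    where
    K : Poly
    K = var ⊕ var ⊗ (con 1 ⊕ var)

  walksᵗ : Tree → Tree → Tree → Tree → Tree → Tree
  walksᵗ E α β q Q = iterateᵗ (expandᵗ (indicesᵗ E) E α β) (initialᵗ (indicesᵗ E) α q Q) E

  -- The concatenation of the table is a clock with at least as many ticks as the walks have edges
  -- in total. The log holds the colorings before each step, so the last one, `β`, is supplied when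
  -- the log is reversed.
  recolorᵗ : Tree → Tree → Tree → Tree
  recolorᵗ E β T = revAppᵗ (tl (iterateᵗ (stepᵗ (indicesᵗ E) E) (T ∙ nil) (concatᵗ T))) (β ∙ nil)

  solveᵗ : Tree → Tree
  solveᵗ s = recolorᵗ E β (walksᵗ E α β q Q)
    where
    E = hd s
    α = hd (tl (tl s))
    β = hd (tl (tl (tl s)))
    q = hd (tl (tl (tl (tl s))))
    Q = tl (tl (tl (tl (tl s))))

  solveᴾ : PolyTime solveᵗ
  solveᴾ = (E ∙ᴾ β ∙ᴾ walks) ⟫
    (((hdᴾ′ ∙ᴾ nilᴾ) ∙ᴾ
       (((indicesᴾ hdᴾ ∙ᴾ hdᴾ) ∙ᴾ ((tlᴾ ⟫ tlᴾ) ∙ᴾ nilᴾ) ∙ᴾ concatᴾ (tlᴾ ⟫ tlᴾ)) ⟫ iterateStepᴾ ⟫ tlᴾ))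
     ⟫ revAppᴾ)
    where
    hdᴾ′ : PolyTime (λ s → hd (tl s))
    hdᴾ′ = tlᴾ ⟫ hdᴾ
    E : PolyTime hd
    E = hdᴾ
    α : PolyTime (λ s → hd (tl (tl s)))
    α = tlᴾ ⟫ tlᴾ ⟫ hdᴾ
    β : PolyTime (λ s → hd (tl (tl (tl s))))
    β = tlᴾ ⟫ tlᴾ ⟫ tlᴾ ⟫ hdᴾ
    walks : PolyTime (λ s → walksᵗ (hd s) (hd (tl (tl s))) (hd (tl (tl (tl s))))
                        (hd (tl (tl (tl (tl s))))) (tl (tl (tl (tl (tl s))))))
    walks = ((indicesᴾ E ∙ᴾ E ∙ᴾ α ∙ᴾ β)
             ∙ᴾ initialᴾ (indicesᴾ E) α (tlᴾ ⟫ tlᴾ ⟫ tlᴾ ⟫ tlᴾ ⟫ hdᴾ) (tlᴾ ⟫ tlᴾ ⟫ tlᴾ ⟫ tlᴾ ⟫ tlᴾ)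
             ∙ᴾ E) ⟫ iterateExpandᴾ

-- The groupoid of reduced walks

module ReducedWalks (G : Graph) where

  open Walks G

  opposite : ∀ {x y} → Adj G x y → Adj G y x
  opposite = Graph.edge-sym G _ _

  ◅-irrelevant : ∀ {x y z} (e e′ : Adj G x y) (W : Walk G y z) → _≡_ {A = Walk G x z} (e ◅ W) (e′ ◅ W)
  ◅-irrelevant e e′ W = cong (_◅ W) (T-irrelevant e e′)

  reduced-tail : ∀ {x y z} (e : Adj G x y) (W : Walk G y z) → Reduced (e ◅ W) → Reduced W
  reduced-tail e ε       _       = []
  reduced-tail e (_ ◅ _) (_ ∷ r) = r

  reduced-turn : ∀ {x y w z} (e : Adj G x y) (f : Adj G y w) (W : Walk G w z) →
                 Reduced (e ◅ f ◅ W) → w ≢ x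
  reduced-turn e f W (f≢ ∷ _) refl = f≢ refl

  reduced-◅ : ∀ {x y w z} (e : Adj G x y) (f : Adj G y w) (W : Walk G w z) →
              w ≢ x → Reduced (f ◅ W) → Reduced (e ◅ f ◅ W)
  reduced-◅ e f W w≢x r = (λ f≡ → w≢x (cong proj₂ f≡)) ∷ r

  cons-cancel : ∀ {x y z} (e : Adj G x y) (f : Adj G y x) (W : Walk G x z) → cons e (f ◅ W) ≡ W
  cons-cancel {x} e f W with x ≟ x
  ... | yes refl = refl
  ... | no x≢x   = ⊥-elim (x≢x refl)

  cons-turn : ∀ {x y w z} (e : Adj G x y) (f : Adj G y w) (W : Walk G w z) →
              w ≢ x → cons e (f ◅ W) ≡ e ◅ f ◅ W
  cons-turn {x} {w = w} e f W w≢x with w ≟ x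
  ... | yes refl = ⊥-elim (w≢x refl)
  ... | no _     = refl

  cons-reduced : ∀ {x y z} (e : Adj G x y) (W : Walk G y z) → Reduced (e ◅ W) → cons e W ≡ e ◅ W
  cons-reduced e ε       r = refl
  cons-reduced e (f ◅ W) r = cons-turn e f W (reduced-turn e f W r)

  reduce-id : ∀ {x y} (W : Walk G x y) → Reduced W → reduce W ≡ W
  reduce-id ε       r = refl
  reduce-id (e ◅ W) r = trans (cong (cons e) (reduce-id W (reduced-tail e W r))) (cons-reduced e W r)

  -- This is the confluence of cancellation. If `f` cancels the first edge of `W`, then `e` is that
  -- edge again, and as `W` is reduced it does not cancel against the next one.
  cons-cons : ∀ {x y z} (e : Adj G x y) (f : Adj G y x) (W : Walk G x z) →
              Reduced W → cons e (cons f W) ≡ W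
  cons-cons         e f ε       r = cons-cancel e f ε
  cons-cons {y = y} e f (_◅_ {j = w} g W) r with w ≟ y
  ... | yes refl = trans (cong (λ e′ → cons e′ W) (T-irrelevant e g)) (cons-reduced g W r)
  ... | no _     = cons-cancel e f (g ◅ W)

  reduce-reduce : ∀ {x y} (W : Walk G x y) → reduce (reduce W) ≡ reduce W
  reduce-reduce W = reduce-id (reduce W) (reduce-reduced W)

  reduce-◅◅ʳ : ∀ {x y z} (A : Walk G x y) (B : Walk G y z) → reduce (A ◅◅ reduce B) ≡ reduce (A ◅◅ B)
  reduce-◅◅ʳ ε       B = reduce-reduce B
  reduce-◅◅ʳ (e ◅ A) B = cong (cons e) (reduce-◅◅ʳ A B)

  reduce-cons : ∀ {x y z w} (e : Adj G x y) (A : Walk G y z) (B : Walk G z w) →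
                reduce (cons e A ◅◅ B) ≡ cons e (reduce (A ◅◅ B))
  reduce-cons     e ε       B = refl
  reduce-cons {x} e (_◅_ {j = w} f A) B with w ≟ x
  ... | yes refl = sym (cons-cons e f (reduce (A ◅◅ B)) (reduce-reduced (A ◅◅ B)))
  ... | no _     = refl

  reduce-◅◅ˡ : ∀ {x y z} (A : Walk G x y) (B : Walk G y z) → reduce (reduce A ◅◅ B) ≡ reduce (A ◅◅ B)
  reduce-◅◅ˡ ε       B = refl
  reduce-◅◅ˡ (e ◅ A) B = trans (reduce-cons e (reduce A) B) (cong (cons e) (reduce-◅◅ˡ A B))

  infix 4 _≈_
  -- A record rather than a synonym for the equation, so that `A` and `B` can be inferred from the
  -- type; `reduce` is not injective.
  record _≈_ {x y} (A B : Walk G x y) : Set where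
    constructor ⟪_⟫
    field reduce≡ : reduce A ≡ reduce B
  open _≈_ public

  walks : (x y : Vertex G) → Setoid _ _
  walks x y = record
    { Carrier = Walk G x y
    ; _≈_ = _≈_
    ; isEquivalence = record
      { refl = ⟪ refl ⟫ ; sym = λ p → ⟪ sym (reduce≡ p) ⟫ ; trans = λ p q → ⟪ trans (reduce≡ p) (reduce≡ q) ⟫ } }

  module ≈ {x y} = Setoid (walks x y)
  module ≈-Reasoning {x y} = SetoidReasoning (walks x y)

  ≈-reduced : ∀ {x y} {A B : Walk G x y} → Reduced A → Reduced B → A ≈ B → A ≡ B
  ≈-reduced {A = A} {B} rA rB p = trans (sym (reduce-id A rA)) (trans (reduce≡ p) (reduce-id B rB))

  reduce-≈ : ∀ {x y} (A : Walk G x y) → reduce A ≈ A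
  reduce-≈ A = ⟪ reduce-reduce A ⟫

  ◅◅-congˡ : ∀ {x y z} {A A′ : Walk G x y} (B : Walk G y z) → A ≈ A′ → A ◅◅ B ≈ A′ ◅◅ B
  ◅◅-congˡ {A = A} {A′} B p =
    ⟪ trans (sym (reduce-◅◅ˡ A B)) (trans (cong (λ R → reduce (R ◅◅ B)) (reduce≡ p)) (reduce-◅◅ˡ A′ B)) ⟫

  ◅◅-congʳ : ∀ {x y z} (A : Walk G x y) {B B′ : Walk G y z} → B ≈ B′ → A ◅◅ B ≈ A ◅◅ B′
  ◅◅-congʳ A {B} {B′} p =
    ⟪ trans (sym (reduce-◅◅ʳ A B)) (trans (cong (λ R → reduce (A ◅◅ R)) (reduce≡ p)) (reduce-◅◅ʳ A B′)) ⟫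

  ◅◅-cong : ∀ {x y z} {A A′ : Walk G x y} {B B′ : Walk G y z} → A ≈ A′ → B ≈ B′ → A ◅◅ B ≈ A′ ◅◅ B′
  ◅◅-cong {A′ = A′} {B} p q = ≈.trans (◅◅-congˡ B p) (◅◅-congʳ A′ q)

  backtrack : ∀ {x y z} (e : Adj G x y) (f : Adj G y x) (W : Walk G x z) → e ◅ f ◅ W ≈ W
  backtrack e f W = ⟪ cons-cons e f (reduce W) (reduce-reduced W) ⟫

  ◅◅-ε : ∀ {x y} (A : Walk G x y) → A ◅◅ ε ≡ A
  ◅◅-ε ε       = refl
  ◅◅-ε (e ◅ A) = cong (e ◅_) (◅◅-ε A)

  revApp-◅◅ : ∀ {x y z w} (A : Walk G x y) (B : Walk G x z) (C : Walk G z w) →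
              revApp opposite A (B ◅◅ C) ≡ revApp opposite A B ◅◅ C
  revApp-◅◅ ε       B C = refl
  revApp-◅◅ (e ◅ A) B C = revApp-◅◅ A (opposite e ◅ B) C

  ⁻¹-◅ : ∀ {x y z} (e : Adj G x y) (A : Walk G y z) → (e ◅ A) ⁻¹ ≡ A ⁻¹ ◅◅ opposite e ◅ ε
  ⁻¹-◅ e A = revApp-◅◅ A ε (opposite e ◅ ε)

  ⁻¹-involutive : ∀ {x y} (A : Walk G x y) → (A ⁻¹) ⁻¹ ≡ A
  ⁻¹-involutive A = trans (twice A ε ε) (◅◅-ε A)
    where
    twice : ∀ {x y z w} (A : Walk G x y) (B : Walk G x z) (C : Walk G y w) →
            revApp opposite (revApp opposite A B) C ≡ revApp opposite B (A ◅◅ C)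
    twice ε       B C = refl
    twice (e ◅ A) B C = trans (twice A (opposite e ◅ B) C)
      (cong (revApp opposite B) (◅-irrelevant (opposite (opposite e)) e (A ◅◅ C)))

  inverseˡ : ∀ {x y} (A : Walk G x y) → A ⁻¹ ◅◅ A ≈ ε
  inverseˡ ε       = ≈.refl
  inverseˡ (e ◅ A) = begin
    (e ◅ A) ⁻¹ ◅◅ e ◅ A                  ≡⟨ cong (_◅◅ e ◅ A) (⁻¹-◅ e A) ⟩
    (A ⁻¹ ◅◅ opposite e ◅ ε) ◅◅ e ◅ A    ≡⟨ ◅◅-assoc (A ⁻¹) (opposite e ◅ ε) (e ◅ A) ⟩
    A ⁻¹ ◅◅ opposite e ◅ e ◅ A           ≈⟨ ◅◅-congʳ (A ⁻¹) (backtrack (opposite e) e A) ⟩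
    A ⁻¹ ◅◅ A                            ≈⟨ inverseˡ A ⟩
    ε                                    ∎
    where open ≈-Reasoning

  inverseʳ : ∀ {x y} (A : Walk G x y) → A ◅◅ A ⁻¹ ≈ ε
  inverseʳ A = subst (λ B → B ◅◅ A ⁻¹ ≈ ε) (⁻¹-involutive A) (inverseˡ (A ⁻¹))

  cancelˡ : ∀ {x y z} (A : Walk G x y) (B : Walk G y z) → A ⁻¹ ◅◅ A ◅◅ B ≈ B
  cancelˡ A B = ≈.trans (≈.reflexive (sym (◅◅-assoc (A ⁻¹) A B))) (◅◅-congˡ B (inverseˡ A))

  cancelʳ : ∀ {x y z} (A : Walk G x y) (B : Walk G x z) → A ◅◅ A ⁻¹ ◅◅ B ≈ B
  cancelʳ A B = ≈.trans (≈.reflexive (sym (◅◅-assoc A (A ⁻¹) B))) (◅◅-congˡ B (inverseʳ A))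

  ◅◅-cancelˡ : ∀ {x y z} (A : Walk G x y) {B C : Walk G y z} → A ◅◅ B ≈ A ◅◅ C → B ≈ C
  ◅◅-cancelˡ A {B} {C} p = ≈.trans (≈.sym (cancelˡ A B)) (≈.trans (◅◅-congʳ (A ⁻¹) p) (cancelˡ A C))

  ◅◅-cancelʳ : ∀ {x y z} {A B : Walk G x y} (C : Walk G y z) → A ◅◅ C ≈ B ◅◅ C → A ≈ B
  ◅◅-cancelʳ {A = A} {B} C p = ≈.trans (≈.sym (undo A)) (≈.trans (◅◅-congˡ (C ⁻¹) p) (undo B))
    where
    undo : ∀ A → (A ◅◅ C) ◅◅ C ⁻¹ ≈ A
    undo A = ≈.trans (≈.reflexive (◅◅-assoc A C (C ⁻¹)))
               (≈.trans (◅◅-congʳ A (inverseʳ C)) (≈.reflexive (◅◅-ε A)))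

  ⁻¹-cong : ∀ {x y} {A B : Walk G x y} → A ≈ B → A ⁻¹ ≈ B ⁻¹
  ⁻¹-cong {A = A} {B} p = ◅◅-cancelˡ A
    (≈.trans (inverseʳ A) (≈.trans (≈.sym (inverseʳ B)) (◅◅-congˡ (B ⁻¹) (≈.sym p))))

  private
    -- The condition at the junction of the reversed first walk with the second one: no backtracking
    -- at their common start.
    Apart : ∀ {x y z} → Walk G x y → Walk G x z → Set
    Apart ε               _               = ⊤
    Apart (_ ◅ _)         ε               = ⊤
    Apart (_◅_ {j = y} _ _) (_◅_ {j = z} _ _) = z ≢ y

    revApp-reduced : ∀ {x y z} (A : Walk G x y) (B : Walk G x z) → Reduced A → Reduced B → Apart A B →
                     Reduced (revApp opposite A B)
    revApp-reduced ε       B rA rB A#B = rB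
    revApp-reduced (e ◅ A) B rA rB A#B =
      revApp-reduced A (opposite e ◅ B) (reduced-tail e A rA) (extend B rB A#B) (apart A rA)
      where
      extend : ∀ {z} (B : Walk G _ z) → Reduced B → Apart (e ◅ A) B → Reduced (opposite e ◅ B)
      extend ε       rB B# = [-]
      extend (f ◅ B) rB B# = reduced-◅ (opposite e) f B B# rB
      apart : ∀ {y} (A : Walk G _ y) → Reduced (e ◅ A) → Apart A (opposite e ◅ B)
      apart ε       r = tt
      apart (g ◅ A) r = reduced-turn e g A r ∘ sym

  ⁻¹-reduced : ∀ {x y} (A : Walk G x y) → Reduced A → Reduced (A ⁻¹)
  ⁻¹-reduced ε       r = []
  ⁻¹-reduced (e ◅ A) r = revApp-reduced (e ◅ A) ε r [] tt

  length-◅◅ : ∀ {x y z} (A : Walk G x y) (B : Walk G y z) → length (A ◅◅ B) ≡ length A + length B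
  length-◅◅ ε       B = refl
  length-◅◅ (e ◅ A) B = cong suc (length-◅◅ A B)

  length-⁻¹ : ∀ {x y} (A : Walk G x y) → length (A ⁻¹) ≡ length A
  length-⁻¹ ε       = refl
  length-⁻¹ (e ◅ A) = trans (cong length (⁻¹-◅ e A))
    (trans (length-◅◅ (A ⁻¹) (opposite e ◅ ε)) (trans (+-comm _ 1) (cong suc (length-⁻¹ A))))

  reduced-◅◅ : ∀ {x y z} (A : Walk G x y) (B : Walk G y z) → Reduced (A ◅◅ B) → Reduced B
  reduced-◅◅ ε       B r = r
  reduced-◅◅ (e ◅ A) B r = reduced-◅◅ A B (reduced-tail e (A ◅◅ B) r)

  length-cons : ∀ {x y z} (e : Adj G x y) (W : Walk G y z) →
                ∃[ k ] (2 ∣ k × suc (length W) ≡ k + length (cons e W))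
  length-cons     e ε = 0 , divides 0 refl , refl
  length-cons {x} e (_◅_ {j = w} f W) with w ≟ x
  ... | yes refl = 2 , ∣-refl , refl
  ... | no _     = 0 , divides 0 refl , refl

  length-reduce : ∀ {x y} (W : Walk G x y) → ∃[ k ] (2 ∣ k × length W ≡ k + length (reduce W))
  length-reduce ε       = 0 , divides 0 refl , refl
  length-reduce (e ◅ W) with length-reduce W | length-cons e (reduce W)
  ... | k , 2∣k , p | l , 2∣l , q = k + l , ∣m∣n⇒∣m+n 2∣k 2∣l , (begin
    suc (length W)                            ≡⟨ cong suc p ⟩
    suc (k + length (reduce W))               ≡⟨ +-suc k _ ⟨
    k + suc (length (reduce W))               ≡⟨ cong (k +_) q ⟩
    k + (l + length (cons e (reduce W)))      ≡⟨ +-assoc k l _ ⟨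
    k + l + length (cons e (reduce W))        ∎)
    where
    open ≡-Reasoning

  even-reduce : ∀ {x y} (W : Walk G x y) → 2 ∣ length W → 2 ∣ length (reduce W)
  even-reduce W 2∣W with length-reduce W
  ... | k , 2∣k , p = ∣m+n∣m⇒∣n (subst (2 ∣_) p 2∣W) 2∣k

  -- An appended edge can cancel only the last edge of a reduced walk, so with two or more edges the
  -- first one survives. This is how the first edge of the walk of a blocking vertex becomes
  -- visible.
  reduce-▻ : ∀ {x y w z u} (e : Adj G x y) (g : Adj G y w) (W : Walk G w z) (f : Adj G z u) →
             Reduced (e ◅ g ◅ W) →
             reduce ((e ◅ g ◅ W) ◅◅ f ◅ ε) ≡ e ◅ reduce ((g ◅ W) ◅◅ f ◅ ε)
  reduce-▻ {y = y} e g ε f r with cons g (f ◅ ε) in eq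
  reduce-▻ {y = y} {u = u} e g ε f r | R with u ≟ y
  ... | yes refl = subst (λ R → cons e R ≡ e ◅ R) eq refl
  ... | no _     = subst (λ R → cons e R ≡ e ◅ R) eq (cons-turn e g (f ◅ ε) (reduced-turn e g ε r))
  reduce-▻ e g (h ◅ W) f r = trans
    (cong (cons e) (reduce-▻ g h W f r′))
    (trans (cons-turn e g (reduce ((h ◅ W) ◅◅ f ◅ ε)) (reduced-turn e g (h ◅ W) r))
           (cong (e ◅_) (sym (reduce-▻ g h W f r′))))
    where
    r′ : Reduced (g ◅ h ◅ W)
    r′ = reduced-tail e (g ◅ h ◅ W) r

-- Images of walks

module Images (G H : Graph) where

  open Colorings G H
  open Walks using (_⁻¹; length; edges; reduce)
  open ReducedWalks H using (◅-irrelevant; opposite; _≈_; ◅◅-congˡ; ◅◅-congʳ; module ≈; module ≈-Reasoning)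

  image-irrelevant : ∀ σ (h h′ : IsColoring σ) {x y} (W : Walk G x y) → image σ h W ≡ image σ h′ W
  image-irrelevant σ h h′ ε       = refl
  image-irrelevant σ h h′ (e ◅ W) = trans (◅-irrelevant (h _ _ e) (h′ _ _ e) (image σ h W))
                                           (cong (h′ _ _ e ◅_) (image-irrelevant σ h h′ W))

  image-◅◅ : ∀ σ (h : IsColoring σ) {x y z} (A : Walk G x y) (B : Walk G y z) →
             image σ h (A ◅◅ B) ≡ image σ h A ◅◅ image σ h B
  image-◅◅ σ h = gmap-◅◅ _ (λ {u} {v} → h u v)

  image-⁻¹ : ∀ σ (h : IsColoring σ) {x y} (A : Walk G x y) →
             image σ h (_⁻¹ G A) ≡ _⁻¹ H (image σ h A)
  image-⁻¹ σ h A = image-revApp A ε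
    where
    image-revApp : ∀ {x y z} (A : Walk G x y) (B : Walk G x z) →
      image σ h (revApp (ReducedWalks.opposite G) A B) ≡ revApp opposite (image σ h A) (image σ h B)
    image-revApp ε       B = refl
    image-revApp (e ◅ A) B = trans (image-revApp A (ReducedWalks.opposite G e ◅ B))
      (cong (revApp opposite (image σ h A)) (◅-irrelevant _ _ (image σ h B)))

  length-image : ∀ σ (h : IsColoring σ) {x y} (W : Walk G x y) → length H (image σ h W) ≡ length G W
  length-image σ h ε       = refl
  length-image σ h (e ◅ W) = cong suc (length-image σ h W)

  -- Colorings act as functors on walks modulo cancellation, and `S` is a natural transformation
  -- between two of them: naturality on edges extends to walks.
  along : ∀ σ τ (hσ : IsColoring σ) (hτ : IsColoring τ)
          (S : ∀ v → Walk H (lookup σ v) (lookup τ v)) →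
          (∀ {u v} (e : Adj G u v) → hσ u v e ◅ S v ≈ S u ◅◅ hτ u v e ◅ ε) →
          ∀ {u v} (W : Walk G u v) → image σ hσ W ◅◅ S v ≈ S u ◅◅ image τ hτ W
  along σ τ hσ hτ S edge {u} ε = ≈.reflexive (sym (ReducedWalks.◅◅-ε H (S u)))
  along σ τ hσ hτ S edge {u} {v} (_◅_ {j = w} e W) = begin
    hσ u w e ◅ image σ hσ W ◅◅ S v              ≈⟨ ◅◅-congʳ (hσ u w e ◅ ε) (along σ τ hσ hτ S edge W) ⟩
    hσ u w e ◅ S w ◅◅ image τ hτ W              ≈⟨ ◅◅-congˡ (image τ hτ W) (edge e) ⟩
    (S u ◅◅ hτ u w e ◅ ε) ◅◅ image τ hτ W       ≡⟨ ◅◅-assoc (S u) (hτ u w e ◅ ε) (image τ hτ W) ⟩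
    S u ◅◅ hτ u w e ◅ image τ hτ W              ∎
    where open ≈-Reasoning

-- Recoloring sequences and the conditions (i)–(iii)

∣p∣≤1⇒unique : ∀ {n} (p : Subset n) → ∣ p ∣ ≤ 1 → ∀ {x y} → x ∈ₛ p → y ∈ₛ p → x ≡ y
∣p∣≤1⇒unique p ∣p∣≤1 {x} {y} x∈p y∈p with x ≟ y
... | yes x≡y = x≡y
... | no x≢y  with ≤-trans (x∈p⇒∣p-x∣<∣p∣ x∈p) ∣p∣≤1
                 | x∈p⇒∣p-x∣<∣p∣ (x∈p∧x≢y⇒x∈p-y y∈p (x≢y ∘ sym))
...   | s≤s ∣p-x∣≤0 | ∣p-x-y∣<∣p-x∣ = contradiction (≤-trans ∣p-x-y∣<∣p-x∣ ∣p-x∣≤0) λ ()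

module Recolorings (G H : Graph) (isG : IsSource G) (isT : IsTarget H) where

  open Colorings G H
  open Walks H
  open ReducedWalks H
  open Images G H

  common-neighbor-unique : ∀ {a b h h′} → a ≢ b → Adj H a h → Adj H b h → Adj H a h′ → Adj H b h′ → h ≡ h′
  common-neighbor-unique {a} {b} a≢b ah bh ah′ bh′ =
    ∣p∣≤1⇒unique _ (IsTarget.monochromatic isT a b a≢b)
      (x∈p∩q⁺ (∈N ah , ∈N bh)) (x∈p∩q⁺ (∈N ah′ , ∈N bh′))
    where
    ∈N : ∀ {c h} → Adj H c h → h ∈ₛ Graph.N H c
    ∈N {c} {h} ch = lookup⇒[]= h (Graph.N H c)
      (trans (lookup∘tabulate (Graph.edge H c) h) (Equivalence.to T-≡ ch))

  neighbor≢ : ∀ {u w} → Adj G w u → u ≢ w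
  neighbor≢ wu refl = IsSource.loopless isG _ wu

  -- As `G` is loopless, neighbors of the moving vertex keep their colors, and these are adjacent to
  -- both its old and its new color. Two distinct colors have at most one common neighbor.
  neighbors-agree : ∀ {σ τ} (s : Step σ τ) {u u′} → Adj G (Step.vertex s) u → Adj G (Step.vertex s) u′ →
                    lookup σ u ≡ lookup σ u′
  neighbors-agree {σ} {τ} s {u} {u′} wu wu′ =
    common-neighbor-unique changes (before w u wu) (color wu) (before w u′ wu′) (color wu′)
    where
    open Step s renaming (vertex to w)
    color : ∀ {u} → Adj G w u → Adj H (lookup τ w) (lookup σ u)
    color {u} wu = subst (Adj H (lookup τ w)) (sym (fixes u (neighbor≢ wu))) (after w u wu)

  flip : ∀ {σ τ} → Step σ τ → Step τ σ
  flip s = record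
    { before = after ; after = before ; vertex = vertex ; changes = changes ∘ sym
    ; fixes = λ v v≢w → sym (fixes v v≢w) }
    where open Step s

  stepWalk-edge : ∀ {σ τ} (s : Step σ τ) (hσ : IsColoring σ) (hτ : IsColoring τ) {u v} (e : Adj G u v) →
                  hσ u v e ◅ stepWalk isG s v ≈ stepWalk isG s u ◅◅ hτ u v e ◅ ε
  stepWalk-edge {σ} {τ} s hσ hτ {u} {v} e with u ≟ Step.vertex s | v ≟ Step.vertex s
  ... | yes refl | yes refl = ⊥-elim (IsSource.loopless isG _ e)
  ... | no u≢w   | no v≢w   = fixed (Step.fixes s u u≢w) (Step.fixes s v v≢w) (hσ u v e) (hτ u v e)
    where
    -- Stated for arbitrary colors, so that the equations between colors become variables on both
    -- sides and can be matched with `refl`. The local lemmas `forth` and `back`, and many below,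
    -- serve the same purpose.
    fixed : ∀ {a a′ b b′} (p : a ≡ a′) (q : b ≡ b′) (e : Adj H a b) (e′ : Adj H a′ b′) →
            e ◅ subst (Walk H b) q ε ≈ subst (Walk H a) p ε ◅◅ e′ ◅ ε
    fixed refl refl e e′ = ≈.reflexive (◅-irrelevant e e′ ε)
  ... | yes refl | no v≢w =
    forth (neighbors-agree s (proj₂ (IsSource.neighbor isG u)) e) (Step.fixes s v v≢w) (hσ u v e) _ _ (hτ u v e)
    where
    forth : ∀ {a b c c′ h} → h ≡ c → (p : c ≡ c′) (e : Adj H a c) (e₁ : Adj H a h) (e₂ : Adj H h b) (e₃ : Adj H b c′) →
            e ◅ subst (Walk H c) p ε ≈ e₁ ◅ e₂ ◅ e₃ ◅ ε
    forth refl refl e e₁ e₂ e₃ = ≈.trans (≈.reflexive (◅-irrelevant e e₁ ε))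
      (◅◅-congʳ (e₁ ◅ ε) (≈.sym (backtrack e₂ e₃ ε)))
  ... | no u≢w | yes refl =
    back (neighbors-agree s (proj₂ (IsSource.neighbor isG v)) (Graph.edge-sym G u v e)) (Step.fixes s u u≢w)
         (hσ u v e) _ _ (hτ u v e)
    where
    back : ∀ {a b c c′ h} → h ≡ c → (p : c ≡ c′) (e : Adj H c a) (e₁ : Adj H a h) (e₂ : Adj H h b) (e₃ : Adj H c′ b) →
           e ◅ e₁ ◅ e₂ ◅ ε ≈ subst (Walk H c) p ε ◅◅ e₃ ◅ ε
    back refl refl e e₁ e₂ e₃ = ≈.trans (backtrack e e₁ (e₂ ◅ ε)) (≈.reflexive (◅-irrelevant e₂ e₃ ε))

  vertexWalk-edge : ∀ {α β} (S : Recoloring α β) (hα : IsColoring α) (hβ : IsColoring β) {u v} (e : Adj G u v) →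
                    hα u v e ◅ vertexWalk isG S v ≈ vertexWalk isG S u ◅◅ hβ u v e ◅ ε
  vertexWalk-edge ε hα hβ e = ≈.reflexive (◅-irrelevant (hα _ _ e) (hβ _ _ e) ε)
  vertexWalk-edge (s ◅ S) hα hβ {u} {v} e = begin
    hα u v e ◅ stepWalk isG s v ◅◅ vertexWalk isG S v
      ≈⟨ ◅◅-congˡ (vertexWalk isG S v) (stepWalk-edge s hα after e) ⟩
    (stepWalk isG s u ◅◅ after u v e ◅ ε) ◅◅ vertexWalk isG S v
      ≡⟨ ◅◅-assoc (stepWalk isG s u) (after u v e ◅ ε) (vertexWalk isG S v) ⟩
    stepWalk isG s u ◅◅ after u v e ◅ vertexWalk isG S v
      ≈⟨ ◅◅-congʳ (stepWalk isG s u) (vertexWalk-edge S after hβ e) ⟩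
    stepWalk isG s u ◅◅ vertexWalk isG S u ◅◅ hβ u v e ◅ ε
      ≡⟨ ◅◅-assoc (stepWalk isG s u) (vertexWalk isG S u) (hβ u v e ◅ ε) ⟨
    (stepWalk isG s u ◅◅ vertexWalk isG S u) ◅◅ hβ u v e ◅ ε ∎
    where
    open ≈-Reasoning
    open Step s

  stepWalk-even : ∀ {σ τ} (s : Step σ τ) v → 2 ∣ length (stepWalk isG s v)
  stepWalk-even s v with v ≟ Step.vertex s
  ... | no v≢w   = constant (Step.fixes s v v≢w)
    where
    constant : ∀ {a b} (p : a ≡ b) → 2 ∣ length (subst (Walk H a) p ε)
    constant refl = divides 0 refl
  ... | yes refl = ∣-refl

  vertexWalk-even : ∀ {α β} (S : Recoloring α β) v → 2 ∣ length (vertexWalk isG S v)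
  vertexWalk-even ε       v = divides 0 refl
  vertexWalk-even (s ◅ S) v = subst (2 ∣_) (sym (length-◅◅ (stepWalk isG s v) (vertexWalk isG S v)))
    (∣m∣n⇒∣m+n (stepWalk-even s v) (vertexWalk-even S v))

  -- The two neighbors of a vertex on a tight closed walk have distinct colors,
  -- so the vertex cannot be recolored.
  private
    inner-fixed : ∀ {σ τ} (s : Step σ τ) (hσ : IsColoring σ) {p x y} (e : Adj G p x) (W : Walk G x y) →
                  Reduced (image σ hσ (e ◅ W)) → ∀ {v} → v ∈ Walks.vertices G W → v ≡ Step.vertex s → v ≡ y
    inner-fixed {σ} s hσ e ε       r (here refl) eq   = refl
    inner-fixed {σ} s hσ e (f ◅ W) r (here refl) refl = ⊥-elim
      (reduced-turn (hσ _ _ e) (hσ _ _ f) (image σ hσ W) r (neighbors-agree s f (Graph.edge-sym G _ _ e)))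
    inner-fixed {σ} s hσ e (f ◅ W) r (there m)   eq   =
      inner-fixed s hσ f W (reduced-tail (hσ _ _ e) (image σ hσ (f ◅ W)) r) m eq

    last-edge : ∀ σ (hσ : IsColoring σ) {x y z} (f : Adj G x y) (W : Walk G y z) {eₖ} →
                last (edges (image σ hσ (f ◅ W))) ≡ just eₖ →
                ∃[ p ] (Adj G p z × eₖ ≡ (lookup σ p , lookup σ z))
    last-edge σ hσ f ε       refl = _ , f , refl
    last-edge σ hσ f (g ◅ W) eq   = last-edge σ hσ g W eq

  tight-fixed : ∀ {σ τ} (s : Step σ τ) (hσ : IsColoring σ) {x} (C : Walk G x x) → Tight σ hσ C →
                ∀ {v} → v ∈ Walks.vertices G C → v ≢ Step.vertex s
  tight-fixed s hσ ε       (_ , _ , _ , () , _) _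
  tight-fixed {σ} s hσ {x} (f ◅ W) (r , _ , eₖ , refl , last≡ , eₖ≢) = λ where
      (here refl) v≡w → end-fixed v≡w
      (there m)   v≡w → end-fixed (trans (sym (inner-fixed s hσ f W r m v≡w)) v≡w)
    where
    end-fixed : ¬ x ≡ Step.vertex s
    end-fixed refl with last-edge σ hσ f W last≡
    ... | p , px , refl = eₖ≢ (cong (_, lookup σ x) (neighbors-agree s (Graph.edge-sym G p x px) f))

  edges-image-cong : ∀ σ τ (hσ : IsColoring σ) (hτ : IsColoring τ) {x y} (W : Walk G x y) →
    (∀ {v} → v ∈ Walks.vertices G W → lookup σ v ≡ lookup τ v) →
    edges (image σ hσ W) ≡ edges (image τ hτ W)
  edges-image-cong σ τ hσ hτ ε       σ≗τ = refl
  edges-image-cong σ τ hσ hτ (e ◅ W) σ≗τ =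
    cong₂ _∷_ (cong₂ _,_ (σ≗τ (here refl)) (σ≗τ (there (here refl)))) (edges-image-cong σ τ hσ hτ W (σ≗τ ∘ there))

  -- No vertex of the walk moves, so its image is unchanged. The comparison is made on edge lists
  -- because the two images have different endpoint types.
  tight-step : ∀ {σ τ} (s : Step σ τ) (hσ : IsColoring σ) (hτ : IsColoring τ) {x} (C : Walk G x x) →
               Tight σ hσ C → Tight τ hτ C
  tight-step {σ} {τ} s hσ hτ C t = subst
    (λ es → Linked (λ e f → f ≢ swap e) es ×
            (∃[ e₁ ] ∃[ eₖ ] (List.head es ≡ just e₁ × last es ≡ just eₖ × eₖ ≢ swap e₁)))
    (edges-image-cong σ τ hσ hτ C (λ v∈C → Step.fixes s _ (tight-fixed s hσ C t v∈C))) t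

  stepWalk-fixed : ∀ {σ τ} (s : Step σ τ) v → v ≢ Step.vertex s →
                   Σ[ p ∈ lookup σ v ≡ lookup τ v ] stepWalk isG s v ≡ subst (Walk H (lookup σ v)) p ε
  stepWalk-fixed s v v≢w with v ≟ Step.vertex s
  ... | yes v≡w = ⊥-elim (v≢w v≡w)
  ... | no v≢w′ = Step.fixes s v v≢w′ , refl

  vertexWalk-tight : ∀ {α β} (S : Recoloring α β) (hα : IsColoring α) {x} (C : Walk G x x) → Tight α hα C →
                     ∀ v → v ∈ Walks.vertices G C →
                     Σ[ p ∈ lookup α v ≡ lookup β v ] vertexWalk isG S v ≡ subst (Walk H (lookup α v)) p ε
  vertexWalk-tight ε       hα C t v v∈C = refl , refl
  vertexWalk-tight (s ◅ S) hα C t v v∈C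
    with stepWalk-fixed s v (tight-fixed s hα C t v∈C)
       | vertexWalk-tight S (Step.after s) C (tight-step s hα (Step.after s) C t) v v∈C
  ... | p , eq | q , eq′ = trans p q , trans (cong₂ _◅◅_ eq eq′) (compose p q)
    where
    compose : ∀ {a b c} (p : a ≡ b) (q : b ≡ c) →
              subst (Walk H a) p ε ◅◅ subst (Walk H b) q ε ≡ subst (Walk H a) (trans p q) ε
    compose refl refl = refl

-- Necessity of (i)-(iii)

module Necessity (I : Instance) where

  open Instance I
  open ReducedWalks H
  open Recolorings G H isSource isTarget
  open Images G H

  private
    transport : ∀ (S : Recoloring α β) {u v} (W : Walk G u v) → α⟦ W ⟧ ◅◅ S at v ≈ S at u ◅◅ β⟦ W ⟧
    transport S = along α β α-ok β-ok (S at_) (vertexWalk-edge S α-ok β-ok)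

  realizable⇒valid : Realizable → TopologicallyValid
  realizable⇒valid (S , refl) C = reduce≡ (≈.sym (begin
    reduce (Sq ⁻¹ ◅◅ reduce α⟦ C ⟧) ◅◅ Sq    ≈⟨ ◅◅-congˡ Sq (reduce-≈ (Sq ⁻¹ ◅◅ reduce α⟦ C ⟧)) ⟩
    (Sq ⁻¹ ◅◅ reduce α⟦ C ⟧) ◅◅ Sq           ≡⟨ ◅◅-assoc (Sq ⁻¹) (reduce α⟦ C ⟧) Sq ⟩
    Sq ⁻¹ ◅◅ reduce α⟦ C ⟧ ◅◅ Sq             ≈⟨ ◅◅-congʳ (Sq ⁻¹) (◅◅-cong (reduce-≈ α⟦ C ⟧) (reduce-≈ (S at q))) ⟩
    Sq ⁻¹ ◅◅ α⟦ C ⟧ ◅◅ S at q                ≈⟨ ◅◅-congʳ (Sq ⁻¹) (transport S C) ⟩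
    Sq ⁻¹ ◅◅ S at q ◅◅ β⟦ C ⟧                ≈⟨ ◅◅-congʳ (Sq ⁻¹) (◅◅-congˡ β⟦ C ⟧ (≈.sym (reduce-≈ (S at q)))) ⟩
    Sq ⁻¹ ◅◅ Sq ◅◅ β⟦ C ⟧                    ≈⟨ cancelˡ Sq β⟦ C ⟧ ⟩
    β⟦ C ⟧                                   ∎))
    where
    open ≈-Reasoning
    Sq = reduce (S at q)

  realizable⇒even : Realizable → 2 ∣ length Q
  realizable⇒even (S , refl) = even-reduce (S at q) (vertexWalk-even S q)

  realizable⇒determined : Realizable → DeterminedByTightWalks
  realizable⇒determined (S , refl) C t v v∈C W with vertexWalk-tight S α-ok C t v v∈C
  ... | p , eq = p , solve p α⟦ W ⟧ β⟦ W ⟧ (S at q)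
                       (≈.trans (transport S W) (≈.reflexive (cong (_◅◅ β⟦ W ⟧) eq)))
    where
    solve : ∀ {a a′ b c} (p : a ≡ a′) (A : Walk H a c) (B : Walk H a′ b) (R : Walk H c b) →
            A ◅◅ R ≈ subst (Walk H a) p ε ◅◅ B →
            reduce R ≡ (reduce A) ⁻¹ · subst (λ x → Walk H x b) (sym p) (reduce B)
    solve refl A B R AR≈B = reduce≡ (begin
      R                             ≈⟨ cancelˡ A R ⟨
      A ⁻¹ ◅◅ A ◅◅ R                ≈⟨ ◅◅-congʳ (A ⁻¹) AR≈B ⟩
      A ⁻¹ ◅◅ B                     ≈⟨ ◅◅-cong (⁻¹-cong (reduce-≈ A)) (reduce-≈ B) ⟨
      (reduce A) ⁻¹ ◅◅ reduce B     ∎)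
      where open ≈-Reasoning

-- Recolorings that perform prescribed vertex walks

module Pending (G H : Graph) (isG : IsSource G) (isT : IsTarget H) where

  open Colorings G H
  open Walks H
  open ReducedWalks H
  open Images G H
  open Recolorings G H isG isT

  -- The clause for `ε` is a dummy value; the blocking argument looks only at nonempty walks.
  second : ∀ {x y} → Walk H x y → Vertex H
  second {x} ε                  = x
  second     (_◅_ {j = y} _ _) = y

  -- S v is the walk that v has yet to perform in a recoloring from σ to β.
  record Plan (σ β : Assignment) : Set where
    field
      σ-ok    : IsColoring σ
      β-ok    : IsColoring β
      S       : ∀ v → Walk H (lookup σ v) (lookup β v)
      reduced : ∀ v → Reduced (S v)
      even    : ∀ v → 2 ∣ length (S v)
      edge    : ∀ {u v} (e : Adj G u v) → σ-ok u v e ◅ S v ≈ S u ◅◅ β-ok u v e ◅ ε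
      tight   : ∀ {x} (C : Walk G x x) → Tight σ σ-ok C → ∀ v → v ∈ Walks.vertices G C → length (S v) ≡ 0

    Blocks : Vertex G → Vertex G → Set
    Blocks u v = Adj G v u × lookup σ u ≢ second (S v)

    Ready : Vertex G → Set
    Ready v = length (S v) ≢ 0 × (∀ u → Adj G v u → lookup σ u ≡ second (S v))

    -- The naturality equation solved for `S u`. Blocking propagates along this formula, and the
    -- program uses it as a recursion to compute the walks.
    transfer : ∀ {u v} (e : Adj G u v) → S u ≈ σ-ok u v e ◅ S v ◅◅ β-ok v u (Graph.edge-sym G u v e) ◅ ε
    transfer {u} {v} e = begin
      S u                                       ≡⟨ ◅◅-ε (S u) ⟨
      S u ◅◅ ε                                  ≈⟨ ◅◅-congʳ (S u) (backtrack f f⁻¹ ε) ⟨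
      S u ◅◅ f ◅ f⁻¹ ◅ ε                        ≡⟨ ◅◅-assoc (S u) (f ◅ ε) (f⁻¹ ◅ ε) ⟨
      (S u ◅◅ f ◅ ε) ◅◅ f⁻¹ ◅ ε                 ≈⟨ ◅◅-congˡ (f⁻¹ ◅ ε) (edge e) ⟨
      σ-ok u v e ◅ S v ◅◅ f⁻¹ ◅ ε               ∎
      where
      open ≈-Reasoning
      f = β-ok u v e
      f⁻¹ = β-ok v u (Graph.edge-sym G u v e)

  record TwoSteps {a c} (W : Walk H a c) : Set where
    constructor twoSteps
    field
      {h b} : Vertex H
      e₁    : Adj H a h
      e₂    : Adj H h b
      R     : Walk H b c
      split : W ≡ e₁ ◅ e₂ ◅ R

  two-steps : ∀ {a c} (W : Walk H a c) → 2 ∣ length W → length W ≢ 0 → TwoSteps W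
  two-steps ε             2∣W W≢0 = contradiction refl W≢0
  two-steps (e ◅ ε)       2∣W W≢0 with ∣⇒≤ 2∣W
  ... | s≤s ()
  two-steps (e₁ ◅ e₂ ◅ R) 2∣W W≢0 = twoSteps e₁ e₂ R refl

  module _ {σ β} (plan : Plan σ β) where

    open Plan plan

    -- The walk of a blocking vertex u starts with the edge from u to the
    -- blocked vertex v: nothing cancels at the start of σ(u,v) ◅ S v.
    blocks⇒active : ∀ {u v} → length (S v) ≢ 0 → Blocks u v → length (S u) ≢ 0 × second (S u) ≡ lookup σ v
    blocks⇒active {u} {v} Sv≢0 (vu , σu≢) =
      extended (σ-ok u v uv) (S v) _ (S u) (reduced v) (reduced u) (two-steps (S v) (even v) Sv≢0) σu≢ (transfer uv)
      where
      uv = Graph.edge-sym G v u vu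
      extended : ∀ {c a b d} (e : Adj H c a) (W : Walk H a b) (f : Adj H b d) (X : Walk H c d) →
                 Reduced W → Reduced X → TwoSteps W → c ≢ second W → X ≈ e ◅ W ◅◅ f ◅ ε →
                 length X ≢ 0 × second X ≡ a
      extended {c} {a} e W f X rW rX (twoSteps e₁ e₂ R refl) c≢ X≈
        with trans (sym (reduce-id X rX)) (trans (reduce≡ X≈)
               (reduce-▻ e e₁ (e₂ ◅ R) f (reduced-◅ e e₁ (e₂ ◅ R) (c≢ ∘ sym) rW)))
      ... | refl = (λ ()) , refl

    module _ (blocked : ∀ v → length (S v) ≢ 0 → ∃[ u ] Blocks u v) where

      -- The successor of an active vertex depends on the proof that it is active. Recurrence is
      -- therefore only claimed for vertices and not for elements of `Active`.
      private
        Active : Set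
        Active = Σ[ v ∈ Vertex G ] length (S v) ≢ 0

        vertex : Active → Vertex G
        vertex = proj₁

        next : Active → Active
        next (v , v≢0) with blocked v v≢0
        ... | u , u-blocks-v = u , proj₁ (blocks⇒active v≢0 u-blocks-v)

        next-blocks : ∀ x → Blocks (vertex (next x)) (vertex x)
        next-blocks (v , v≢0) = proj₂ (blocked v v≢0)

        second-next : ∀ x → second (S (vertex (next x))) ≡ lookup σ (vertex x)
        second-next (v , v≢0) = proj₂ (blocks⇒active v≢0 (proj₂ (blocked v v≢0)))

        _times_ : ℕ → Active → Active
        zero  times x = x
        suc k times x = k times next x

        times-+ : ∀ i d x → (i + d) times x ≡ d times (i times x)
        times-+ zero    d x = refl
        times-+ (suc i) d x = times-+ i d (next x)

        path : ∀ k x → Walk G (vertex x) (vertex (k times x))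
        path zero    x = ε
        path (suc k) x = proj₁ (next-blocks x) ◅ path k (next x)

        -- At an inner vertex `z` the preceding color is `second (S z)`, by `second-next`, and the
        -- following color differs from it because the following vertex blocks `z`.
        path-reduced : ∀ k x → Reduced (image σ σ-ok (path k x))
        path-reduced zero          x = []
        path-reduced (suc zero)    x = [-]
        path-reduced (suc (suc k)) x = reduced-◅ (σ-ok _ _ (proj₁ (next-blocks x)))
          (σ-ok _ _ (proj₁ (next-blocks (next x)))) (image σ σ-ok (path k (next (next x))))
          (λ eq → proj₂ (next-blocks (next x)) (trans eq (sym (second-next x))))
          (path-reduced (suc k) (next x))

        path-last : ∀ k x → let z = vertex (suc k times x) in
                    last (edges (image σ σ-ok (path (suc k) x))) ≡ just (second (S z) , lookup σ z)
        path-last zero    x = cong (λ c → just (c , lookup σ (vertex (next x)))) (sym (second-next x))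
        path-last (suc k) x = path-last k (next x)

        -- At the junction the argument for inner vertices applies once more: the last edge arrives
        -- from `second (S x)`, and the first edge leaves to a color other than that. So the closed
        -- walk is tight and `S x` must be empty.
        close : ∀ {x z} (W : Walk G x z) → x ≡ z → Reduced (image σ σ-ok W) → ∀ {c} →
                head (edges (image σ σ-ok W)) ≡ just (lookup σ x , c) →
                last (edges (image σ σ-ok W)) ≡ just (second (S z) , lookup σ z) →
                c ≢ second (S x) → length (S x) ≡ 0
        close {x} W refl r head≡ last≡ c≢ =
          tight W (r , _ , _ , head≡ , last≡ , λ eq → c≢ (sym (cong proj₁ eq))) x (here refl)

        no-active : ¬ Active
        no-active x₀ with pigeonhole (n<1+n (Graph.order G)) (λ i → vertex (toℕ i times x₀))
        -- From `i < j` one gets `j = i + suc d`; the closed walk has `suc d` edges and is thus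
        -- nonempty.
        ... | i , j , i<j , eq with m≤n⇒∃[o]m+o≡n i<j
        ...   | d , 1+i+d≡j = proj₂ x
                (close (path (suc d) x) x≡z (path-reduced (suc d) x) refl (path-last d x) (proj₂ (next-blocks x)))
          where
          x = toℕ i times x₀
          x≡z : vertex x ≡ vertex (suc d times x)
          x≡z = trans eq (cong vertex (trans
            (cong (_times x₀) (trans (sym 1+i+d≡j) (sym (+-suc (toℕ i) d)))) (times-+ (toℕ i) (suc d) x₀)))

      -- Passing from blocked to blocking vertices must eventually return to
      -- some vertex and then traverses a tight closed walk.
      blocked⇒finished : ∀ v → length (S v) ≡ 0
      blocked⇒finished v with length (S v) ℕ.≟ 0
      ... | yes Sv≡0 = Sv≡0
      ... | no Sv≢0  = ⊥-elim (no-active (v , Sv≢0))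

    -- The equation `factors` holds on the nose and not just up to cancellation. This is why the
    -- vertex walks of the whole recoloring end up equal to the planned ones, and so reduced.
    record Advance (w : Vertex G) : Set where
      field
        {τ}         : Assignment
        step        : Step σ τ
        step-vertex : Step.vertex step ≡ w
        plan′       : Plan τ β
        factors     : ∀ v → S v ≡ stepWalk isG step v ◅◅ Plan.S plan′ v

    advance : ∀ w → Ready w → Advance w
    advance w (Sw≢0 , ready) with two-steps (S w) (even w) Sw≢0
    ... | twoSteps {h} {b} e₁ e₂ R split = record
      { step = step ; step-vertex = refl ; factors = λ v → proj₂ (residual v)
      ; plan′ = record
        { σ-ok = τ-ok ; β-ok = β-ok ; S = S′
        ; reduced = λ v → reduced-◅◅ (stepWalk isG step v) (S′ v) (subst Reduced (factors v) (reduced v))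
        ; even = λ v → ∣m+n∣m⇒∣n
            (subst (2 ∣_) (trans (cong length (factors v)) (length-◅◅ (stepWalk isG step v) (S′ v))) (even v))
            (stepWalk-even step v)
        ; edge = edge′
        -- A walk that is tight after the step was tight before it, by the reversed step; there
        -- `S v` is empty, and so is its second factor.
        ; tight = λ C t v v∈C → m+n≡0⇒n≡0 (length (stepWalk isG step v))
            (trans (sym (length-◅◅ (stepWalk isG step v) (S′ v)))
              (trans (sym (cong length (factors v)))
                (tight C (tight-step (flip step) τ-ok σ-ok C t) v v∈C))) } }
      where
      τ : Assignment
      τ = σ [ w ]≔ b

      h≡ : second (S w) ≡ h
      h≡ = cong second split

      τw≡b : lookup τ w ≡ b
      τw≡b = lookup∘update w σ b

      τ≡σ : ∀ v → v ≢ w → lookup τ v ≡ lookup σ v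
      τ≡σ v v≢w = lookup∘update′ v≢w σ b

      w-ok : ∀ v → Adj G w v → Adj H (lookup τ w) (lookup τ v)
      w-ok v wv = subst₂ (Adj H) (sym τw≡b) (sym (trans (τ≡σ v (neighbor≢ wv)) (trans (ready v wv) h≡)))
                         (opposite e₂)

      τ-ok : IsColoring τ
      τ-ok u v uv with u ≟ w | v ≟ w
      ... | yes refl | _        = w-ok v uv
      ... | no _     | yes refl = opposite (w-ok u (Graph.edge-sym G u v uv))
      ... | no u≢w   | no v≢w   = subst₂ (Adj H) (sym (τ≡σ u u≢w)) (sym (τ≡σ v v≢w)) (σ-ok u v uv)

      σw≢τw : lookup σ w ≢ lookup τ w
      σw≢τw eq = reduced-turn e₁ e₂ R (subst Reduced split (reduced w)) (sym (trans eq τw≡b))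

      step : Step σ τ
      step = record { before = σ-ok ; after = τ-ok ; vertex = w ; changes = σw≢τw
                    ; fixes = λ v v≢w → sym (τ≡σ v v≢w) }

      residual : ∀ v → Σ[ X ∈ Walk H (lookup τ v) (lookup β v) ] S v ≡ stepWalk isG step v ◅◅ X
      residual v with v ≟ w
      ... | yes refl = moved (sym (trans (ready _ (proj₂ (IsSource.neighbor isG v))) h≡)) (sym τw≡b)
                             e₁ e₂ R _ _ (S v) split
        where
        moved : ∀ {a h h′ b b′ c} → h ≡ h′ → b ≡ b′ → (e₁ : Adj H a h) (e₂ : Adj H h b) (R : Walk H b c)
                (e₁′ : Adj H a h′) (e₂′ : Adj H h′ b′) (W : Walk H a c) → W ≡ e₁ ◅ e₂ ◅ R →
                Σ[ X ∈ Walk H b′ c ] W ≡ e₁′ ◅ e₂′ ◅ X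
        moved refl refl e₁ e₂ R e₁′ e₂′ W eq =
          R , trans eq (trans (◅-irrelevant e₁ e₁′ (e₂ ◅ R)) (cong (e₁′ ◅_) (◅-irrelevant e₂ e₂′ R)))
      ... | no v≢w = unmoved (sym (τ≡σ v v≢w)) (S v)
        where
        unmoved : ∀ {a a′ c} (p : a ≡ a′) (W : Walk H a c) →
                  Σ[ X ∈ Walk H a′ c ] W ≡ subst (Walk H a) p ε ◅◅ X
        unmoved refl W = W , refl

      S′ : ∀ v → Walk H (lookup τ v) (lookup β v)
      S′ v = proj₁ (residual v)

      factors : ∀ v → S v ≡ stepWalk isG step v ◅◅ S′ v
      factors v = proj₂ (residual v)

      -- Both the old plan and the step are natural; cancelling the walk of the step at `u` leaves
      -- naturality of the rest.
      edge′ : ∀ {u v} (e : Adj G u v) → τ-ok u v e ◅ S′ v ≈ S′ u ◅◅ β-ok u v e ◅ ε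
      edge′ {u} {v} e = ◅◅-cancelˡ (stepWalk isG step u) (begin
        stepWalk isG step u ◅◅ τ-ok u v e ◅ S′ v             ≡⟨ ◅◅-assoc (stepWalk isG step u) (τ-ok u v e ◅ ε) (S′ v) ⟨
        (stepWalk isG step u ◅◅ τ-ok u v e ◅ ε) ◅◅ S′ v      ≈⟨ ◅◅-congˡ (S′ v) (stepWalk-edge step σ-ok τ-ok e) ⟨
        σ-ok u v e ◅ stepWalk isG step v ◅◅ S′ v             ≡⟨ cong (σ-ok u v e ◅_) (factors v) ⟨
        σ-ok u v e ◅ S v                                     ≈⟨ edge e ⟩
        S u ◅◅ β-ok u v e ◅ ε                                ≡⟨ cong (_◅◅ β-ok u v e ◅ ε) (factors u) ⟩
        (stepWalk isG step u ◅◅ S′ u) ◅◅ β-ok u v e ◅ ε      ≡⟨ ◅◅-assoc (stepWalk isG step u) (S′ u) (β-ok u v e ◅ ε) ⟩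
        stepWalk isG step u ◅◅ S′ u ◅◅ β-ok u v e ◅ ε        ∎)
        where open ≈-Reasoning

-- The plan determined by Q

module InitialPlan (I : Instance) where

  open Instance I
  open ReducedWalks H
  open Images G H
  open Pending G H isSource isTarget

  module _ (valid : TopologicallyValid) (Q-even : 2 ∣ length Q) (determined : DeterminedByTightWalks) where

    conjugate : ∀ {v} → Walk G v q → Walk H (lookup α v) (lookup β v)
    conjugate W = α⟦ W ⟧ ◅◅ Q ◅◅ β⟦ W ⟧ ⁻¹

    private
      commutes : ∀ (C : Walk G q q) → Q ◅◅ β⟦ C ⟧ ≈ α⟦ C ⟧ ◅◅ Q
      commutes C = begin
        Q ◅◅ β⟦ C ⟧                                  ≈⟨ ◅◅-congʳ Q (≈.trans (≈.sym (reduce-≈ β⟦ C ⟧)) (≈.reflexive (valid C))) ⟩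
        Q ◅◅ (Q ⁻¹ · reduce α⟦ C ⟧ · Q)              ≈⟨ ◅◅-congʳ Q (≈.trans
                                                          (reduce-≈ ((Q ⁻¹ · reduce α⟦ C ⟧) ◅◅ Q))
                                                          (◅◅-congˡ Q (reduce-≈ (Q ⁻¹ ◅◅ reduce α⟦ C ⟧)))) ⟩
        Q ◅◅ (Q ⁻¹ ◅◅ reduce α⟦ C ⟧) ◅◅ Q            ≡⟨ cong (Q ◅◅_) (◅◅-assoc (Q ⁻¹) (reduce α⟦ C ⟧) Q) ⟩
        Q ◅◅ Q ⁻¹ ◅◅ reduce α⟦ C ⟧ ◅◅ Q              ≈⟨ cancelʳ Q (reduce α⟦ C ⟧ ◅◅ Q) ⟩
        reduce α⟦ C ⟧ ◅◅ Q                           ≈⟨ ◅◅-congˡ Q (reduce-≈ α⟦ C ⟧) ⟩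
        α⟦ C ⟧ ◅◅ Q                                  ∎
        where open ≈-Reasoning

    -- Two walks from `v` to `q` form a closed walk at `q`, and by (i) conjugation by `Q` takes its
    -- image under α to its image under β.
    conjugate-unique : ∀ {v} (W W′ : Walk G v q) → conjugate W ≈ conjugate W′
    conjugate-unique W W′ = ◅◅-cancelʳ B′ (begin
      (A ◅◅ Q ◅◅ B ⁻¹) ◅◅ B′        ≡⟨ reassoc A Q (B ⁻¹) B′ ⟩
      A ◅◅ Q ◅◅ B ⁻¹ ◅◅ B′          ≡⟨ cong (λ X → A ◅◅ Q ◅◅ X) (closed β β-ok) ⟨
      A ◅◅ Q ◅◅ β⟦ C ⟧              ≈⟨ ◅◅-congʳ A (commutes C) ⟩
      A ◅◅ α⟦ C ⟧ ◅◅ Q              ≡⟨ cong (λ X → A ◅◅ X ◅◅ Q) (closed α α-ok) ⟩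
      A ◅◅ (A ⁻¹ ◅◅ A′) ◅◅ Q        ≡⟨ cong (A ◅◅_) (◅◅-assoc (A ⁻¹) A′ Q) ⟩
      A ◅◅ A ⁻¹ ◅◅ A′ ◅◅ Q          ≈⟨ cancelʳ A (A′ ◅◅ Q) ⟩
      A′ ◅◅ Q                       ≡⟨ cong (A′ ◅◅_) (◅◅-ε Q) ⟨
      A′ ◅◅ Q ◅◅ ε                  ≈⟨ ◅◅-congʳ A′ (◅◅-congʳ Q (inverseˡ B′)) ⟨
      A′ ◅◅ Q ◅◅ B′ ⁻¹ ◅◅ B′        ≡⟨ reassoc A′ Q (B′ ⁻¹) B′ ⟨
      (A′ ◅◅ Q ◅◅ B′ ⁻¹) ◅◅ B′      ∎)
      where
      open ≈-Reasoning
      A  = α⟦ W ⟧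
      A′ = α⟦ W′ ⟧
      B  = β⟦ W ⟧
      B′ = β⟦ W′ ⟧
      C  = Walks._⁻¹ G W ◅◅ W′
      closed : ∀ σ (hσ : IsColoring σ) → image σ hσ C ≡ image σ hσ W ⁻¹ ◅◅ image σ hσ W′
      closed σ hσ = trans (image-◅◅ σ hσ (Walks._⁻¹ G W) W′) (cong (_◅◅ image σ hσ W′) (image-⁻¹ σ hσ W))
      reassoc : ∀ {x y z w u} (A : Walk H x y) (B : Walk H y z) (C : Walk H z w) (D : Walk H w u) →
                (A ◅◅ B ◅◅ C) ◅◅ D ≡ A ◅◅ B ◅◅ C ◅◅ D
      reassoc A B C D = trans (◅◅-assoc A (B ◅◅ C) D) (cong (A ◅◅_) (◅◅-assoc B C D))

    private
      toRoot : ∀ v → Walk G v q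
      toRoot v = IsSource.connected isSource v q

    required : ∀ v → Walk H (lookup α v) (lookup β v)
    required v = reduce (conjugate (toRoot v))

    required-q : required q ≡ Q
    required-q = ≈-reduced (reduce-reduced (conjugate (toRoot q))) reduced
      (≈.trans (reduce-≈ _) (≈.trans (conjugate-unique (toRoot q) ε) (≈.reflexive (◅◅-ε Q))))

    initial : Plan α β
    initial = record
      { σ-ok = α-ok ; β-ok = β-ok ; S = required
      ; reduced = λ v → reduce-reduced (conjugate (toRoot v))
      ; even = λ v → even-reduce (conjugate (toRoot v)) (conjugate-even (toRoot v))
      ; edge = required-edge
      ; tight = λ C t v v∈C → let αv≡βv , Q≡ = determined C t v v∈C (toRoot v)
                              in trivial αv≡βv α⟦ toRoot v ⟧ β⟦ toRoot v ⟧ Q Q≡ }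
      where
      conjugate-even : ∀ {v} (W : Walk G v q) → 2 ∣ length (conjugate W)
      conjugate-even W = subst (2 ∣_) (sym lengths)
        (∣m∣n⇒∣m+n Q-even (divides (Walks.length G W) (double (Walks.length G W))))
        where
        open ≡-Reasoning
        n = Walks.length G W
        double : ∀ n → n + n ≡ n ℕ.* 2
        double = solve-∀
        rearrange : ∀ n m → n + (m + n) ≡ m + (n + n)
        rearrange = solve-∀
        lengths : length (conjugate W) ≡ length Q + (n + n)
        lengths = begin
          length (conjugate W)                                   ≡⟨ length-◅◅ α⟦ W ⟧ (Q ◅◅ β⟦ W ⟧ ⁻¹) ⟩
          length α⟦ W ⟧ + length (Q ◅◅ β⟦ W ⟧ ⁻¹)                ≡⟨ cong (length α⟦ W ⟧ +_) (length-◅◅ Q (β⟦ W ⟧ ⁻¹)) ⟩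
          length α⟦ W ⟧ + (length Q + length (β⟦ W ⟧ ⁻¹))        ≡⟨ cong₂ (λ i j → i + (length Q + j)) (length-image α α-ok W)
                                                                     (trans (length-⁻¹ β⟦ W ⟧) (length-image β β-ok W)) ⟩
          n + (length Q + n)                                     ≡⟨ rearrange n (length Q) ⟩
          length Q + (n + n)                                     ∎

      -- The chosen walk from `u` may be replaced by `e` followed by the chosen walk from `v`; for
      -- that choice the equation is a single cancellation of `f`.
      required-edge : ∀ {u v} (e : Adj G u v) → α-ok u v e ◅ required v ≈ required u ◅◅ β-ok u v e ◅ ε
      required-edge {u} {v} e = begin
        α-ok u v e ◅ required v                              ≈⟨ ◅◅-congʳ (α-ok u v e ◅ ε) (reduce-≈ (conjugate W)) ⟩
        α-ok u v e ◅ A ◅◅ Q ◅◅ B ⁻¹                          ≡⟨ ◅◅-ε _ ⟨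
        (α-ok u v e ◅ A ◅◅ Q ◅◅ B ⁻¹) ◅◅ ε                   ≈⟨ ◅◅-congʳ (α-ok u v e ◅ A ◅◅ Q ◅◅ B ⁻¹)
                                                                  (backtrack (opposite f) f ε) ⟨
        (α-ok u v e ◅ A ◅◅ Q ◅◅ B ⁻¹) ◅◅ opposite f ◅ f ◅ ε  ≡⟨ cong (α-ok u v e ◅_) (reassoc A Q (B ⁻¹) (opposite f) f) ⟩
        (α-ok u v e ◅ A ◅◅ Q ◅◅ B ⁻¹ ◅◅ opposite f ◅ ε) ◅◅ f ◅ ε
                                                             ≡⟨ cong (λ X → (α-ok u v e ◅ A ◅◅ Q ◅◅ X) ◅◅ f ◅ ε) (⁻¹-◅ f B) ⟨
        conjugate (e ◅ W) ◅◅ f ◅ ε                           ≈⟨ ◅◅-congˡ (f ◅ ε) (conjugate-unique (toRoot u) (e ◅ W)) ⟨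
        conjugate (toRoot u) ◅◅ f ◅ ε                        ≈⟨ ◅◅-congˡ (f ◅ ε) (reduce-≈ (conjugate (toRoot u))) ⟨
        required u ◅◅ f ◅ ε                                  ∎
        where
        open ≈-Reasoning
        W = toRoot v
        A = α⟦ W ⟧
        B = β⟦ W ⟧
        f = β-ok u v e
        reassoc : ∀ {x y z w u t} (A : Walk H x y) (B : Walk H y z) (C : Walk H z w)
                  (e : Adj H w u) (f : Adj H u t) →
                  (A ◅◅ B ◅◅ C) ◅◅ e ◅ f ◅ ε ≡ (A ◅◅ B ◅◅ C ◅◅ e ◅ ε) ◅◅ f ◅ ε
        reassoc A B C e f = trans (sym (◅◅-assoc (A ◅◅ B ◅◅ C) (e ◅ ε) (f ◅ ε)))
          (cong (_◅◅ f ◅ ε) (trans (◅◅-assoc A (B ◅◅ C) (e ◅ ε)) (cong (A ◅◅_) (◅◅-assoc B C (e ◅ ε)))))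

      -- By (iii), `Q` is A⁻¹ · B, so A · Q · B⁻¹ cancels completely. The conclusion speaks of the
      -- length because the walk and `ε` have different types until the endpoints are identified.
      trivial : ∀ {a a′ b c} (p : a ≡ a′) (A : Walk H a c) (B : Walk H a′ b) (Q : Walk H c b) →
                Q ≡ (reduce A) ⁻¹ · subst (λ x → Walk H x b) (sym p) (reduce B) →
                length (reduce (A ◅◅ Q ◅◅ B ⁻¹)) ≡ 0
      trivial refl A B _ refl = cong length (reduce≡ (begin
        A ◅◅ (reduce A ⁻¹ · reduce B) ◅◅ B ⁻¹       ≈⟨ ◅◅-congʳ A (◅◅-congˡ (B ⁻¹) (≈.trans
                                                       (reduce-≈ (reduce A ⁻¹ ◅◅ reduce B))
                                                       (◅◅-cong (⁻¹-cong (reduce-≈ A)) (reduce-≈ B)))) ⟩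
        A ◅◅ (A ⁻¹ ◅◅ B) ◅◅ B ⁻¹                    ≡⟨ cong (A ◅◅_) (◅◅-assoc (A ⁻¹) B (B ⁻¹)) ⟩
        A ◅◅ A ⁻¹ ◅◅ B ◅◅ B ⁻¹                      ≈⟨ cancelʳ A (B ◅◅ B ⁻¹) ⟩
        B ◅◅ B ⁻¹                                   ≈⟨ inverseʳ B ⟩
        ε                                           ∎))
        where open ≈-Reasoning

-- Tables

tableᵗ : ∀ {n} → (Fin n → Tree) → Tree
tableᵗ {zero}  f = nil
tableᵗ {suc n} f = f zero ∙ tableᵗ (f ∘ suc)

table-cong : ∀ {n} {f g : Fin n → Tree} → (∀ i → f i ≡ g i) → tableᵗ f ≡ tableᵗ g
table-cong {zero}  f≗g = refl
table-cong {suc n} f≗g = cong₂ _∙_ (f≗g zero) (table-cong (f≗g ∘ suc))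

map-table : ∀ {n} (g : Tree → Tree) (f : Fin n → Tree) → mapᵗ g (tableᵗ f) ≡ tableᵗ (g ∘ f)
map-table {zero}  g f = refl
map-table {suc n} g f = cong (g (f zero) ∙_) (map-table g (f ∘ suc))

length-table : ∀ {n} (f : Fin n → Tree) → lengthᵗ (tableᵗ f) ≡ n
length-table {zero}  f = refl
length-table {suc n} f = cong suc (length-table (f ∘ suc))

drop-∙ : ∀ h t i → tl (dropᵗ (h ∙ t) i) ≡ dropᵗ t i
drop-∙ h t nil     = refl
drop-∙ h t (_ ∙ i) = cong tl (drop-∙ h t i)

nth-table : ∀ {n} (f : Fin n → Tree) i → nthᵗ (tableᵗ f) (encodeFin i) ≡ f i
nth-table f zero    = refl
nth-table f (suc i) = trans (cong hd (drop-∙ (f zero) (tableᵗ (f ∘ suc)) (encodeFin i))) (nth-table (f ∘ suc) i)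

indices-table : ∀ {n} (f : Fin n → Tree) → indicesᵗ (tableᵗ f) ≡ tableᵗ {n} encodeFin
indices-table {zero}  f = refl
indices-table {suc n} f = cong (nil ∙_)
  (trans (cong (mapᵗ (nil ∙_)) (indices-table (f ∘ suc))) (map-table (nil ∙_) encodeFin))

data Find {n} (p : Tree → Tree) (f : Fin n → Tree) (t : Tree) : Set where
  none : (∀ i → p (f i) ≡ nil) → t ≡ nil → Find p f t
  some : ∀ i → p (f i) ≢ nil → t ≡ f i ∙ nil → Find p f t

find-table : ∀ {n} p (f : Fin n → Tree) → Find p f (findᵗ p (tableᵗ f))
find-table {zero}  p f = none (λ ()) refl
find-table {suc n} p f with p (f zero) in eq | find-table p (f ∘ suc)
... | _ ∙ _ | _             = some zero (λ eq′ → contradiction (trans (sym eq) eq′) λ ()) refl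
... | nil   | some i p≢ t≡  = some (suc i) p≢ t≡
... | nil   | none p≡ t≡    = none (λ { zero → eq ; (suc i) → p≡ i }) t≡

encodeList-toList : ∀ {A : Set} {n} (enc : A → Tree) (xs : Vec A n) →
                    encodeList enc (toList xs) ≡ tableᵗ (enc ∘ lookup xs)
encodeList-toList enc []       = refl
encodeList-toList enc (x ∷ xs) = cong (enc x ∙_) (encodeList-toList enc xs)

encodeList-tabulate : ∀ {A : Set} {n} (enc : A → Tree) (f : Fin n → A) →
                      encodeList enc (toList (tabulate f)) ≡ tableᵗ (enc ∘ f)
encodeList-tabulate {n = zero}  enc f = refl
encodeList-tabulate {n = suc n} enc f = cong (enc (f zero) ∙_) (encodeList-tabulate enc (f ∘ suc))

adjacencyᵗ : Graph → Tree
adjacencyᵗ G = tableᵗ (λ u → tableᵗ (λ v → encodeBool (Graph.edge G u v)))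

encodeGraph-table : ∀ G → encodeGraph G ≡ adjacencyᵗ G
encodeGraph-table G = trans (encodeList-tabulate _ (Graph.N G))
  (table-cong (λ u → encodeList-tabulate encodeBool (Graph.edge G u)))

encodeℕ-injective : ∀ m n → encodeℕ m ≡ encodeℕ n → m ≡ n
encodeℕ-injective zero    zero    eq = refl
encodeℕ-injective (suc m) (suc n) eq = cong suc (encodeℕ-injective m n (cong tl eq))

encodeFin-injective : ∀ {n} {i j : Fin n} → encodeFin i ≡ encodeFin j → i ≡ j
encodeFin-injective eq = toℕ-injective (encodeℕ-injective _ _ eq)

ifᵗ-≡ : ∀ {s t a b} → s ≡ t → ifᵗ (eqᵗ s t) a b ≡ a
ifᵗ-≡ {s} {t} s≡t with s ≟ᵗ t
... | yes _  = refl
... | no s≢t = contradiction s≡t s≢t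

ifᵗ-≢ : ∀ {s t a b} → s ≢ t → ifᵗ (eqᵗ s t) a b ≡ b
ifᵗ-≢ {s} {t} s≢t with s ≟ᵗ t
... | yes s≡t = contradiction s≡t s≢t
... | no _    = refl

-- Sums

total : ∀ {n} → (Fin n → ℕ) → ℕ
total {zero}  f = 0
total {suc n} f = f zero + total (f ∘ suc)

total-mono : ∀ {n} {f g : Fin n → ℕ} → (∀ i → f i ≤ g i) → total f ≤ total g
total-mono {zero}  f≤g = z≤n
total-mono {suc n} f≤g = +-mono-≤ (f≤g zero) (total-mono (f≤g ∘ suc))

total-strict : ∀ {n} {f g : Fin n → ℕ} → (∀ i → f i ≤ g i) → ∀ j → f j < g j → total f < total g
total-strict f≤g zero    f<g = +-mono-<-≤ f<g (total-mono (f≤g ∘ suc))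
total-strict f≤g (suc j) f<g = +-mono-≤-< (f≤g zero) (total-strict (f≤g ∘ suc) j f<g)

total≡0 : ∀ {n} (f : Fin n → ℕ) → total f ≡ 0 → ∀ i → f i ≡ 0
total≡0 f eq zero    = m+n≡0⇒m≡0 (f zero) eq
total≡0 f eq (suc i) = total≡0 (f ∘ suc) (m+n≡0⇒n≡0 (f zero) eq) i

≡0⇒total : ∀ {n} (f : Fin n → ℕ) → (∀ i → f i ≡ 0) → total f ≡ 0
≡0⇒total {zero}  f f≡0 = refl
≡0⇒total {suc n} f f≡0 = cong₂ _+_ (f≡0 zero) (≡0⇒total (f ∘ suc) (f≡0 ∘ suc))

total≢0 : ∀ {n} (f : Fin n → ℕ) → total f ≢ 0 → ∃[ i ] f i ≢ 0
total≢0 {zero}  f ≢0 = contradiction refl ≢0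
total≢0 {suc n} f ≢0 with f zero ℕ.≟ 0
... | no f0≢0  = zero , f0≢0
... | yes f0≡0 with total≢0 (f ∘ suc) (λ eq → ≢0 (trans (cong (_+ total (f ∘ suc)) f0≡0) eq))
...   | i , fi≢0 = suc i , fi≢0

total≤ : ∀ {n} (f : Fin n → ℕ) → (∀ i → f i ≤ 1) → total f ≤ n
total≤ {zero}  f f≤1 = z≤n
total≤ {suc n} f f≤1 = +-mono-≤ (f≤1 zero) (total≤ (f ∘ suc) (f≤1 ∘ suc))

-- In the right fold the head of the clock belongs to the last round; here the first round is split
-- off instead, as an induction along the run requires.
iterate-∙ : ∀ f z h t → iterateᵗ f z (h ∙ t) ≡ iterateᵗ f (f z) t
iterate-∙ f z h nil     = refl
iterate-∙ f z h (k ∙ t) = cong f (iterate-∙ f z h t)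

-- Walks as lists of vertices

module EncodedWalks (H : Graph) where

  open Walks H
  open ReducedWalks H
  open Algorithm

  -- Unlike the edge list, the vertex list of an empty walk still shows where the walk is, that is,
  -- the color of its vertex.
  encodeVertices : ∀ {x y} → Walk H x y → Tree
  encodeVertices W = encodeList encodeFin (vertices W)

  cons-encode : ∀ {x y z} (e : Adj H x y) (W : Walk H y z) →
                consᵗ (encodeFin x) (encodeVertices W) ≡ encodeVertices (cons e W)
  cons-encode     e ε = refl
  cons-encode {x} e (_◅_ {j = w} f W) with w ≟ x
  ... | yes refl = ifᵗ-≡ {encodeFin x} refl
  ... | no w≢x   = ifᵗ-≢ (w≢x ∘ encodeFin-injective)

  rev-encode : ∀ {x y} (W : Walk H x y) → revᵗ (encodeVertices W) ≡ encodeVertices (W ⁻¹)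
  rev-encode W = revApp-encode W ε
    where
    revApp-encode : ∀ {x y z} (W : Walk H x y) (B : Walk H x z) →
      revAppᵗ (tl (encodeVertices W)) (encodeVertices B) ≡ encodeVertices (revApp opposite W B)
    revApp-encode ε       B = refl
    revApp-encode (e ◅ W) B = revApp-encode W (opposite e ◅ B)

  -- The last edge is appended by prepending its opposite to the inverse walk. The outcome is
  -- reduced and equivalent to `X`, hence equal to it.
  extend-encode : ∀ {a b c d} (e : Adj H a b) (W : Walk H b c) (f : Adj H c d) (X : Walk H a d) →
    Reduced W → Reduced X → X ≈ e ◅ W ◅◅ f ◅ ε →
    extendᵗ (encodeFin a) (encodeFin d) (encodeVertices W) ≡ encodeVertices X
  extend-encode {a} {d = d} e W f X rW rX X≈ = begin
    revᵗ (consᵗ (encodeFin d) (revᵗ (consᵗ (encodeFin a) (encodeVertices W))))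
      ≡⟨ cong (λ t → revᵗ (consᵗ (encodeFin d) (revᵗ t))) (cons-encode e W) ⟩
    revᵗ (consᵗ (encodeFin d) (revᵗ (encodeVertices (cons e W))))
      ≡⟨ cong (λ t → revᵗ (consᵗ (encodeFin d) t)) (rev-encode (cons e W)) ⟩
    revᵗ (consᵗ (encodeFin d) (encodeVertices Y))
      ≡⟨ cong revᵗ (cons-encode (opposite f) Y) ⟩
    revᵗ (encodeVertices (cons (opposite f) Y))
      ≡⟨ rev-encode (cons (opposite f) Y) ⟩
    encodeVertices (cons (opposite f) Y ⁻¹)
      ≡⟨ cong encodeVertices (≈-reduced (⁻¹-reduced _ (proj₁ (cons-reduced-≈ (opposite f) Y rY))) rX Y≈X) ⟩
    encodeVertices X ∎
    where
    open ≡-Reasoning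
    cons-reduced-≈ : ∀ {x y z} (e : Adj H x y) (W : Walk H y z) → Reduced W →
                     Reduced (cons e W) × cons e W ≈ e ◅ W
    cons-reduced-≈ e W r = subst (λ R → Reduced R × R ≈ e ◅ W) (cong (cons e) (reduce-id W r))
                             (reduce-reduced (e ◅ W) , reduce-≈ (e ◅ W))
    Y = cons e W ⁻¹
    rY : Reduced Y
    rY = ⁻¹-reduced (cons e W) (proj₁ (cons-reduced-≈ e W rW))
    Y≈X : cons (opposite f) Y ⁻¹ ≈ X
    Y≈X = ≈.trans (⁻¹-cong (proj₂ (cons-reduced-≈ (opposite f) Y rY)))
      (≈.trans (≈.reflexive (⁻¹-◅ (opposite f) Y))
      (≈.trans (≈.reflexive (cong₂ _◅◅_ (⁻¹-involutive (cons e W)) (◅-irrelevant _ f ε)))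
      (≈.trans (◅◅-congˡ (f ◅ ε) (proj₂ (cons-reduced-≈ e W rW))) (≈.sym X≈))))

-- Correctness of the program

module Correctness (G H : Graph) (isG : IsSource G) (isT : IsTarget H) where

  open Colorings G H
  open Walks H
  open ReducedWalks H
  open Recolorings G H isG isT
  open Pending G H isG isT
  open EncodedWalks H
  open Algorithm

  private
    n : ℕ
    n = Graph.order G

    I E : Tree
    I = tableᵗ {n} encodeFin
    E = adjacencyᵗ G

    adjacency : ∀ u v → nthᵗ (nthᵗ E (encodeFin u)) (encodeFin v) ≡ encodeBool (Graph.edge G u v)
    adjacency u v = trans (cong (λ t → nthᵗ t (encodeFin v)) (nth-table _ u)) (nth-table _ v)

    colorsᵗ : Assignment → Tree
    colorsᵗ σ = tableᵗ (λ v → encodeFin (lookup σ v))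

    encodeMap-table : ∀ σ → encodeMap σ ≡ colorsᵗ σ
    encodeMap-table = encodeList-toList encodeFin

    data Decides (P : Set) (t : Tree) : Set where
      true  : P → t ≢ nil → Decides P t
      false : ¬ P → t ≡ nil → Decides P t

    indicator≤1 : ∀ b → (if b then 0 else 1) ≤ 1
    indicator≤1 true  = z≤n
    indicator≤1 false = ≤-refl

  module _ {α β : Assignment} (plan : Plan α β) where

    open Plan plan

    private
      known : Bool → Tree → Tree
      known b t = if b then t else nil

      partial : (Vertex G → Bool) → Tree
      partial K = tableᵗ (λ v → known (K v) (encodeVertices (S v)))

      unknown : (Vertex G → Bool) → ℕ
      unknown K = total (λ v → if K v then 0 else 1)

      -- The set known after a round is read off from what the program does instead of being given
      -- by a formula; `keep` and `grow` are what the count of unknown vertices relies on.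
      record Expansion (K : Vertex G → Bool) (u : Vertex G) (t : Tree) : Set where
        field
          now  : Bool
          t≡   : t ≡ known now (encodeVertices (S u))
          keep : K u ≡ true → now ≡ true
          grow : ∀ v → Adj G u v → K v ≡ true → now ≡ true

      knownNeighbor : ∀ K u v → knownNeighborᵗ E (partial K) (encodeFin u) (encodeFin v) ≡
                      known (Graph.edge G u v) (known (K v) (encodeVertices (S v)))
      knownNeighbor K u v rewrite adjacency u v | nth-table (λ v → known (K v) (encodeVertices (S v))) v
        with Graph.edge G u v
      ... | true  = refl
      ... | false = refl

      -- By `transfer` every known neighbor yields the same walk for `u`, so it does not matter
      -- which one the search returns.
      expand-entry : ∀ K u → Expansion K u
        (ifᵗ (nthᵗ (partial K) (encodeFin u)) (nthᵗ (partial K) (encodeFin u))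
          (entryᵗ (colorsᵗ α) (colorsᵗ β) (partial K) (encodeFin u)
            (findᵗ (knownNeighborᵗ E (partial K) (encodeFin u)) I)))
      expand-entry K u rewrite nth-table (λ v → known (K v) (encodeVertices (S v))) u with K u in Ku
      ... | true  = record { now = true ; t≡ = refl ; keep = λ _ → refl ; grow = λ _ _ _ → refl }
      ... | false with findᵗ (knownNeighborᵗ E (partial K) (encodeFin u)) I
                     | find-table {n} (knownNeighborᵗ E (partial K) (encodeFin u)) encodeFin
      ...   | _ | none all-nil refl = record { now = false ; t≡ = refl ; keep = trans (sym Ku)
                ; grow = λ v uv Kv → contradiction (trans (sym (knownNeighbor K u v)) (all-nil v)) (not-nil uv Kv) }
        where
        not-nil : ∀ {v} → Adj G u v → K v ≡ true →
                  known (Graph.edge G u v) (known (K v) (encodeVertices (S v))) ≢ nil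
        not-nil {v} uv Kv eq with Graph.edge G u v | K v
        not-nil {v} uv refl () | true | _
      ...   | _ | some v p≢nil refl = record { now = true ; keep = λ _ → refl ; grow = λ _ _ _ → refl
                ; t≡ = trans (cong₂ (λ x y → extendᵗ x y (nthᵗ (partial K) (encodeFin v)))
                                  (nth-table _ u) (nth-table _ u))
                         (trans (cong (extendᵗ _ _) (trans (nth-table _ v) Sv))
                           (extend-encode (σ-ok u v uv) (S v) (β-ok v u (Graph.edge-sym G u v uv)) (S u)
                             (reduced v) (reduced u) (transfer uv))) }
        where
        split : ∀ b c {t} → known b (known c t) ≢ nil → Bool.T b × c ≡ true
        split true  true  _  = _ , refl
        split true  false ≢n = contradiction refl ≢n
        split false c     ≢n = contradiction refl ≢n
        facts : Adj G u v × K v ≡ true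
        facts = split (Graph.edge G u v) (K v) (p≢nil ∘ trans (knownNeighbor K u v))
        uv = proj₁ facts
        Sv : known (K v) (encodeVertices (S v)) ≡ encodeVertices (S v)
        Sv = cong (λ b → known b (encodeVertices (S v))) (proj₂ facts)

      next : (Vertex G → Bool) → Vertex G → Bool
      next K u = Expansion.now (expand-entry K u)

      expand-partial : ∀ K → expandᵗ I E (colorsᵗ α) (colorsᵗ β) (partial K) ≡ partial (next K)
      expand-partial K = trans (map-table _ encodeFin) (table-cong (λ u → Expansion.t≡ (expand-entry K u)))

      -- The walk from an unknown to a known vertex has an edge that leaves the unknown part; its
      -- unknown end has a known neighbor and is learned in this round.
      frontier : ∀ K {u q} → K u ≡ false → K q ≡ true → Walk G u q →
                 ∃[ v ] (K v ≡ false × next K v ≡ true)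
      frontier K Ku Kq ε = contradiction (trans (sym Ku) Kq) λ ()
      frontier K {u} Ku Kq (_◅_ {j = v} e W) with K v in Kv
      ... | true  = u , Ku , Expansion.grow (expand-entry K u) v e Kv
      ... | false = frontier K Kv Kq W

      -- While something is unknown, connectivity provides a frontier vertex; once nothing is,
      -- `pred 0 = 0` lets the remaining rounds pass.
      unknown-next : ∀ K {q} → K q ≡ true → unknown (next K) ≤ pred (unknown K)
      unknown-next K {q} Kq with unknown K ℕ.≟ 0
      ... | yes ≡0 = ≤-trans (≤-reflexive (≡0⇒total _ (λ v → kept v (total≡0 _ ≡0 v)))) z≤n
        where
        kept : ∀ v → (if K v then 0 else 1) ≡ 0 → (if next K v then 0 else 1) ≡ 0
        kept v eq with K v in Kv
        kept v eq | true = cong (λ b → if b then 0 else 1) (Expansion.keep (expand-entry K v) Kv)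
      ... | no ≢0 with total≢0 _ ≢0
      ...   | u , u≢0 with frontier K (unknown-u u≢0) Kq (IsSource.connected isG u q)
        where
        unknown-u : ∀ {u} → (if K u then 0 else 1) ≢ 0 → K u ≡ false
        unknown-u {u} ≢0 with K u
        ... | true  = contradiction refl ≢0
        ... | false = refl
      ...     | v , Kv , nextKv = <⇒≤pred (total-strict mono v
                  (subst₂ (λ b c → (if b then 0 else 1) < (if c then 0 else 1)) (sym nextKv) (sym Kv) ≤-refl))
        where
        mono : ∀ w → (if next K w then 0 else 1) ≤ (if K w then 0 else 1)
        mono w with K w in Kw
        ... | true  = ≤-reflexive (cong (λ b → if b then 0 else 1) (Expansion.keep (expand-entry K w) Kw))
        ... | false = indicator≤1 (next K w)

      expansions : ∀ K {q} → K q ≡ true → ∀ l →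
        Σ[ K′ ∈ (Vertex G → Bool) ]
          ( iterateᵗ (expandᵗ I E (colorsᵗ α) (colorsᵗ β)) (partial K) l ≡ partial K′
          × K′ q ≡ true × unknown K′ ≤ n ∸ lengthᵗ l)
      expansions K Kq nil = K , refl , Kq , total≤ _ (λ v → indicator≤1 (K v))
      expansions K Kq (h ∙ t) with expansions K Kq t
      ... | K′ , eq , K′q , ≤n∸t = next K′ ,
              trans (cong (expandᵗ I E (colorsᵗ α) (colorsᵗ β)) eq) (expand-partial K′) ,
              Expansion.keep (expand-entry K′ _) K′q ,
              ≤-trans (unknown-next K′ K′q)
                (≤-trans (pred-mono-≤ ≤n∸t) (≤-reflexive (pred[m∸n]≡m∸[1+n] n (lengthᵗ t))))

    walksTable : Tree
    walksTable = tableᵗ (encodeVertices ∘ S)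

    walks-correct : ∀ q (Q : Walk H (lookup α q) (lookup β q)) → S q ≡ Q →
      walksᵗ E (encodeMap α) (encodeMap β) (encodeFin q) (encodeWalk H Q) ≡ walksTable
    walks-correct q Q Sq≡Q rewrite encodeMap-table α | encodeMap-table β
                                 | indices-table (λ u → tableᵗ (λ v → encodeBool (Graph.edge G u v)))
      -- At the start only `q` is known. The rows of `E` are the clock, giving one round per vertex
      -- of `G`.
      with expansions (λ v → does (v ≟ q)) {q} q-known E
      where
      q-known : does (q ≟ q) ≡ true
      q-known with q ≟ q
      ... | yes _  = refl
      ... | no q≢q = contradiction refl q≢q
    ... | K , eq , _ , ≤0 = trans (cong (λ z → iterateᵗ (expandᵗ I E (colorsᵗ α) (colorsᵗ β)) z E) start)
            (trans eq (table-cong (λ v → cong (λ b → known b (encodeVertices (S v))) (all-known v))))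
      where
      tails : ∀ es → mapᵗ tl (encodeList (λ (x , y) → encodeFin x ∙ encodeFin y) es) ≡
                     encodeList encodeFin (List.map proj₂ es)
      tails []       = refl
      tails (_ ∷ es) = cong (_ ∙_) (tails es)
      start : initialᵗ I (colorsᵗ α) (encodeFin q) (encodeWalk H Q) ≡ partial (λ v → does (v ≟ q))
      start = trans (map-table _ encodeFin) (table-cong entry)
        where
        entry : ∀ v → ifᵗ (eqᵗ (encodeFin v) (encodeFin q))
                          (nthᵗ (colorsᵗ α) (encodeFin v) ∙ mapᵗ tl (encodeWalk H Q)) nil ≡
                      known (does (v ≟ q)) (encodeVertices (S v))
        entry v with v ≟ q
        ... | yes refl = trans (ifᵗ-≡ {encodeFin v} refl)
                (trans (cong₂ _∙_ (nth-table (λ v → encodeFin (lookup α v)) v) (tails (edges Q)))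
                       (cong encodeVertices (sym Sq≡Q)))
        ... | no v≢q   = ifᵗ-≢ (v≢q ∘ encodeFin-injective)
      all-known : ∀ v → K v ≡ true
      all-known v with K v | total≡0 _ (n≤0⇒n≡0 (≤-trans ≤0 (≤-reflexive
                               (trans (cong (n ∸_) (length-table (λ u → tableᵗ (λ v → encodeBool (Graph.edge G u v)))))
                                      (n∸n≡0 n))))) v
      ... | true | _ = refl

    private
      tl-encode : ∀ {x y} (W : Walk H x y) →
                  length W ≡ 0 ⊎ (length W ≢ 0 × ∃[ t ] tl (encodeVertices W) ≡ encodeFin (second W) ∙ t)
      tl-encode ε       = inj₁ refl
      tl-encode (e ◅ W) = inj₂ ((λ ()) , _ , refl)

      tl-nil : ∀ {x y} (W : Walk H x y) → length W ≡ 0 → tl (encodeVertices W) ≡ nil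
      tl-nil ε refl = refl

      nth-walks : ∀ v → nthᵗ walksTable (encodeFin v) ≡ encodeVertices (S v)
      nth-walks = nth-table (encodeVertices ∘ S)

      blocking-decides : ∀ v → length (S v) ≢ 0 → ∀ u →
                         Decides (Blocks u v) (blockingᵗ E walksTable (encodeFin v) (encodeFin u))
      blocking-decides v Sv≢0 u with tl-encode (S v)
      ... | inj₁ Sv≡0 = contradiction Sv≡0 Sv≢0
      ... | inj₂ (_ , t , tl≡) rewrite adjacency v u | nth-walks u | nth-walks v | tl≡ with Graph.edge G v u
      ...   | false = false proj₁ refl
      ...   | true with lookup α u ≟ second (S v)
      ...     | yes eq = false (λ b → proj₂ b eq) (ifᵗ-≡ (cong encodeFin eq))
      ...     | no neq = true (_ , neq) λ eq → contradiction
                  (trans (sym (ifᵗ-≢ {b = nil ∙ nil} (neq ∘ encodeFin-injective))) eq) λ ()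

      data Readiness (v : Vertex G) (t : Tree) : Set where
        ready    : Ready v → t ≢ nil → Readiness v t
        notReady : (length (S v) ≢ 0 → ∃[ u ] Blocks u v) → t ≡ nil → Readiness v t

      readiness : ∀ v → Readiness v (readyᵗ I E walksTable (encodeFin v))
      readiness v = decide _ _ (nth-walks v) (find-table {n} (blockingᵗ E walksTable (encodeFin v)) encodeFin)
        where
        -- The table entry and the search result are abstracted, so that both can be replaced by
        -- their known forms through matching.
        decide : ∀ w b → w ≡ encodeVertices (S v) → Find (blockingᵗ E walksTable (encodeFin v)) (encodeFin {n}) b →
                 Readiness v (ifᵗ (tl w) (ifᵗ b nil (nil ∙ nil)) nil)
        decide _ _ refl found with tl-encode (S v)
        decide _ _ refl found | inj₁ Sv≡0 =
          notReady (contradiction Sv≡0) (cong (λ t → ifᵗ t _ nil) (tl-nil (S v) Sv≡0))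
        decide _ _ refl (none all-nil refl) | inj₂ (Sv≢0 , _ , tl≡) = ready (Sv≢0 , agree)
          λ eq → contradiction (trans (sym (cong (λ t → ifᵗ t (nil ∙ nil) nil) tl≡)) eq) λ ()
          where
          agree : ∀ u → Adj G v u → lookup α u ≡ second (S v)
          agree u vu with lookup α u ≟ second (S v) | blocking-decides v Sv≢0 u
          ... | yes eq | _          = eq
          ... | no neq | true _ ≢n  = contradiction (all-nil u) ≢n
          ... | no neq | false ¬b _ = contradiction (vu , neq) ¬b
        decide _ _ refl (some u ≢nil refl) | inj₂ (Sv≢0 , _ , tl≡) =
          notReady (λ _ → u , blocks) (cong (λ t → ifᵗ t nil nil) tl≡)
          where
          blocks : Blocks u v
          blocks with blocking-decides v Sv≢0 u
          ... | true b _   = b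
          ... | false _ ≡n = contradiction ≡n ≢nil

    data StepResult (next : Tree → Tree) : Set where
      stop : (∀ v → length (S v) ≡ 0) → (∀ out → next out ≡ walksTable ∙ out) → StepResult next
      move : ∀ w (adv : Advance plan w) → length (S w) ≢ 0 →
             (∀ out → next out ≡ tableᵗ (encodeVertices ∘ Plan.S (Advance.plan′ adv)) ∙ encodeMap α ∙ out) →
             StepResult next

    factor-fixed : ∀ {w} (adv : Advance plan w) v → v ≢ w →
      encodeVertices (S v) ≡ encodeVertices (Plan.S (Advance.plan′ adv) v) ×
      length (S v) ≡ length (Plan.S (Advance.plan′ adv) v)
    factor-fixed adv v v≢w with Advance.factors adv v | stepWalk-fixed step v (λ eq → v≢w (trans eq step-vertex))
      where open Advance adv
    ... | eq | p , eq′ = unmoved p (S v) (Plan.S (Advance.plan′ adv) v) (trans eq (cong (_◅◅ _) eq′))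
      where
      unmoved : ∀ {a a′ c} (p : a ≡ a′) (W : Walk H a c) (X : Walk H a′ c) → W ≡ subst (Walk H a) p ε ◅◅ X →
                encodeVertices W ≡ encodeVertices X × length W ≡ length X
      unmoved refl W X refl = refl , refl

    factor-moved : ∀ {w} (adv : Advance plan w) →
      tl (tl (encodeVertices (S w))) ≡ encodeVertices (Plan.S (Advance.plan′ adv) w) ×
      length (S w) ≡ 2 + length (Plan.S (Advance.plan′ adv) w)
    factor-moved {w} record { step = step ; step-vertex = refl ; plan′ = plan′ ; factors = factors }
      with S w | stepWalk isG step w | factors w | stepWalk-vertex
      where
      stepWalk-vertex : ∃[ h ] Σ[ e₁ ∈ Adj H (lookup α w) h ] Σ[ e₂ ∈ Adj H h _ ] stepWalk isG step w ≡ e₁ ◅ e₂ ◅ ε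
      stepWalk-vertex with w ≟ w
      ... | yes refl = _ , _ , _ , refl
      ... | no w≢w   = contradiction refl w≢w
    ... | _ | _ | refl | h , e₁ , e₂ , refl = refl , refl

    shift-correct : ∀ {w} (adv : Advance plan w) v →
      shiftᵗ walksTable (encodeFin w) (encodeFin v) ≡ encodeVertices (Plan.S (Advance.plan′ adv) v)
    shift-correct {w} adv v rewrite nth-walks v with v ≟ w
    ... | yes refl = trans (ifᵗ-≡ {encodeFin v} refl) (proj₁ (factor-moved adv))
    ... | no v≢w   = trans (ifᵗ-≢ (v≢w ∘ encodeFin-injective)) (proj₁ (factor-fixed adv v v≢w))

    -- If the search finds no ready vertex, every nonempty walk is blocked, and `blocked⇒finished`
    -- shows that there are none.
    step-correct : StepResult (λ out → stepᵗ I E (walksTable ∙ out))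
    step-correct with findᵗ (readyᵗ I E walksTable) I | find-table {n} (readyᵗ I E walksTable) encodeFin
    ... | _ | none all-nil refl = stop (blocked⇒finished plan blocked) (λ _ → refl)
      where
      blocked : ∀ v → length (S v) ≢ 0 → ∃[ u ] Blocks u v
      blocked v with readiness v
      ... | ready _ ≢n   = contradiction (all-nil v) ≢n
      ... | notReady b _ = b
    ... | _ | some w ≢nil refl with readiness w
    ...   | notReady _ ≡n = contradiction ≡n ≢nil
    ...   | ready r _ = move w (advance plan w r) (proj₁ r)
              (λ out → cong₂ _∙_ (trans (map-table _ encodeFin) (table-cong (shift-correct (advance plan w r))))
                         (cong (_∙ out) (trans (map-table hd (encodeVertices ∘ S)) (sym (encodeMap-table α)))))

  remaining : ∀ {σ β} → Plan σ β → ℕ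
  remaining plan = total (λ v → length (Plan.S plan v))

  remaining-decreases : ∀ {σ β} (plan : Plan σ β) {w} (adv : Advance plan w) →
                        remaining (Advance.plan′ adv) < remaining plan
  remaining-decreases plan {w} adv = total-strict shorter w
    (≤-trans (n≤1+n _) (≤-reflexive (sym (proj₂ (factor-moved plan adv)))))
    where
    shorter : ∀ v → length (Plan.S (Advance.plan′ adv) v) ≤ length (Plan.S plan v)
    shorter v with v ≟ w
    ... | yes refl = ≤-trans (m≤n+m _ 2) (≤-reflexive (sym (proj₂ (factor-moved plan adv))))
    ... | no v≢w   = ≤-reflexive (sym (proj₂ (factor-fixed plan adv v v≢w)))

  private
    Executes : ∀ {σ β} → Plan σ β → Recoloring σ β → Set
    Executes plan R = ∀ v → vertexWalk isG R v ≡ Plan.S plan v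

    -- Empty walks force σ and β to agree at every vertex; since assignments are vectors, this makes
    -- them equal, and the empty recoloring has the right type.
    finish : ∀ {σ β} (plan : Plan σ β) → (∀ v → length (Plan.S plan v) ≡ 0) →
             Σ[ R ∈ Recoloring σ β ] (Executes plan R × encodeRecoloring G H R ≡ encodeMap β ∙ nil)
    finish {σ} {β} plan S≡0 = go σ≡β (Plan.S plan) S≡0
      where
      endpoints : ∀ {x y} (W : Walk H x y) → length W ≡ 0 → x ≡ y
      endpoints ε refl = refl
      σ≡β : σ ≡ β
      σ≡β = trans (sym (tabulate∘lookup σ))
        (trans (tabulate-cong (λ v → endpoints (Plan.S plan v) (S≡0 v))) (tabulate∘lookup β))
      empty : ∀ {x} (W : Walk H x x) → length W ≡ 0 → ε ≡ W
      empty ε refl = refl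
      go : ∀ {σ β} → σ ≡ β → (S : ∀ v → Walk H (lookup σ v) (lookup β v)) → (∀ v → length (S v) ≡ 0) →
           Σ[ R ∈ Recoloring σ β ] ((∀ v → vertexWalk isG R v ≡ S v) × encodeRecoloring G H R ≡ encodeMap β ∙ nil)
      go refl S S≡0 = ε , (λ v → empty (S v) (S≡0 v)) , refl

    -- Excess ticks of the clock do no harm: a further move would need a nonempty walk.
    iterate-finished : ∀ {σ β} (plan : Plan σ β) → (∀ v → length (Plan.S plan v) ≡ 0) → ∀ out l →
      iterateᵗ (stepᵗ I E) (walksTable plan ∙ out) l ≡ walksTable plan ∙ out
    iterate-finished plan S≡0 out nil     = refl
    iterate-finished plan S≡0 out (h ∙ t) with iterateᵗ (stepᵗ I E) (walksTable plan ∙ out) t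
                                             | iterate-finished plan S≡0 out t
    ... | _ | refl with step-correct plan
    ...   | stop _ eq       = eq out
    ...   | move w _ Sw≢0 _ = contradiction (S≡0 w) Sw≢0

  -- The induction is on the clock, which suffices because each step shortens the total of the
  -- remaining walks. The log `out` is arbitrary, as it grows from one step to the next.
  run-correct : ∀ {σ β} (plan : Plan σ β) l → remaining plan ≤ lengthᵗ l →
    Σ[ R ∈ Recoloring σ β ] (Executes plan R × (∀ out →
      revAppᵗ (tl (iterateᵗ (stepᵗ I E) (walksTable plan ∙ out) l)) (encodeMap β ∙ nil) ≡
      revAppᵗ out (encodeRecoloring G H R)))
  run-finished : ∀ {σ β} (plan : Plan σ β) l → (∀ v → length (Plan.S plan v) ≡ 0) →
    Σ[ R ∈ Recoloring σ β ] (Executes plan R × (∀ out →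
      revAppᵗ (tl (iterateᵗ (stepᵗ I E) (walksTable plan ∙ out) l)) (encodeMap β ∙ nil) ≡
      revAppᵗ out (encodeRecoloring G H R)))
  run-finished {β = β} plan l S≡0 with finish plan S≡0
  ... | R , executes , R≡ = R , executes , λ out →
    trans (cong (λ s → revAppᵗ (tl s) (encodeMap β ∙ nil)) (iterate-finished plan S≡0 out l))
          (cong (revAppᵗ out) (sym R≡))
  run-correct plan nil     ≤0 = run-finished plan nil (total≡0 _ (n≤0⇒n≡0 ≤0))
  run-correct {σ} {β} plan (h ∙ t) ≤l with step-correct plan
  ... | stop S≡0 _ = run-finished plan (h ∙ t) S≡0
  ... | move w adv _ stepped with run-correct (Advance.plan′ adv) t (≤-pred (≤-trans (remaining-decreases plan adv) ≤l))
  ...   | R , executes , R≡ = Advance.step adv ◅ R ,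
            (λ v → trans (cong (stepWalk isG (Advance.step adv) v ◅◅_) (executes v)) (sym (Advance.factors adv v))) ,
            λ out → trans (cong (λ s → revAppᵗ (tl s) (encodeMap β ∙ nil))
                             (trans (iterate-∙ (stepᵗ I E) (walksTable plan ∙ out) h t)
                                    (cong (λ z → iterateᵗ (stepᵗ I E) z t) (stepped out))))
                          (R≡ (encodeMap σ ∙ out))

-- The algorithm on encoded instances

open Algorithm

length-concat : ∀ {n} (f : Fin n → Tree) → lengthᵗ (concatᵗ (tableᵗ f)) ≡ total (lengthᵗ ∘ f)
length-concat {zero}  f = refl
length-concat {suc n} f = trans (length-append (f zero) (concatᵗ (tableᵗ (f ∘ suc))))
                                (cong (lengthᵗ (f zero) +_) (length-concat (f ∘ suc)))
  where
  length-append : ∀ w a → lengthᵗ (foldrᵗ _∙_ a w) ≡ lengthᵗ w + lengthᵗ a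
  length-append nil     a = refl
  length-append (_ ∙ w) a = cong suc (length-append w a)

open InitialPlan using (initial; required-q)

module _ (I : Instance) where

  open Instance I
  open Necessity I
  open Pending G H isSource isTarget
  open Correctness G H isSource isTarget
  open EncodedWalks H

  solve-correct : (plan : Plan α β) → Plan.S plan q ≡ Q →
    Σ[ S ∈ Recoloring α β ] (solveᵗ (encodeInstance I) ≡ encodeRecoloring G H S
                             × S at q ≡ Q × (∀ v → Reduced (S at v)))
  solve-correct plan Sq≡Q with run-correct plan (concatᵗ (walksTable plan)) enough
    where
    length-encode : ∀ {x y} (W : Walk H x y) → length W ≤ lengthᵗ (encodeVertices W)
    length-encode W = ≤-trans (≤-reflexive (length-edges (edges W))) (n≤1+n _)
      where
      length-edges : ∀ es → List.length es ≡ lengthᵗ (encodeList encodeFin (List.map proj₂ es))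
      length-edges []       = refl
      length-edges (_ ∷ es) = cong suc (length-edges es)
    -- A vertex list has one entry more than its walk has edges, so the clock covers all remaining
    -- edges.
    enough : remaining plan ≤ lengthᵗ (concatᵗ (walksTable plan))
    enough = ≤-trans (total-mono (λ v → length-encode (Plan.S plan v)))
                     (≤-reflexive (sym (length-concat (encodeVertices ∘ Plan.S plan))))
  ... | S , executes , S≡ = S , solved , trans (executes q) Sq≡Q ,
          λ v → subst Reduced (sym (executes v)) (Plan.reduced plan v)
    where
    solved : solveᵗ (encodeInstance I) ≡ encodeRecoloring G H S
    solved rewrite encodeGraph-table G | walks-correct plan q Q Sq≡Q
                 | indices-table (λ u → tableᵗ (λ v → encodeBool (Graph.edge G u v))) = S≡ nil

  -- The witness of sufficiency is the output of the program; its walk at `q` is `Q` itself, which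
  -- reduction leaves unchanged.
  realizable⇔ : Realizable ⇔ (TopologicallyValid × 2 ∣ length Q × DeterminedByTightWalks)
  realizable⇔ = mk⇔
    (λ r → realizable⇒valid r , realizable⇒even r , λ {x} → realizable⇒determined r {x})
    (λ (valid , even , determined) →
      let S , _ , Sq≡Q , _ = solve-correct (initial I valid even determined) (required-q I valid even determined)
      in S , trans (cong reduce Sq≡Q) (ReducedWalks.reduce-id H Q reduced))

explicit-bound : ∀ {f} (F : PolyTime f) →
  Σ[ c ∈ ℕ ] Σ[ k ∈ ℕ ] (∀ s → Σ[ t ∈ ℕ ] (Run (PolyTime.program F) s (f s) t × t ≤ c * size s ^ k + c))
explicit-bound F = c , k , λ s → let t , run , t≤ = PolyTime.run F s in
  t , run , ≤-trans t≤ (≤-trans (bound (size s) (1≤size s)) (m≤m+n _ c))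
  where
  c = proj₁ (eval-bound (PolyTime.time F))
  k = proj₁ (proj₂ (eval-bound (PolyTime.time F)))
  bound = proj₂ (proj₂ (eval-bound (PolyTime.time F)))

-- Abstracting from solveᴾ keeps Agda from normalizing the program.
algorithm : PolyTime solveᵗ → Σ[ P ∈ Program ] Σ[ c ∈ ℕ ] Σ[ k ∈ ℕ ]
    ((I : Instance) → let open Instance I in
    TopologicallyValid → 2 ∣ length Q → DeterminedByTightWalks →
    Σ[ S ∈ Recoloring α β ] Σ[ t ∈ ℕ ]
    ( Run P (encodeInstance I) (encodeRecoloring G H S) t
    × t ≤ c * size (encodeInstance I) ^ k + c
    × S at q ≡ Q
    × (∀ v → Reduced (S at v))))
algorithm F with explicit-bound F
... | c , k , runs = PolyTime.program F , c , k , λ I valid even determined →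
  let S , solved , Sq≡Q , reduced = solve-correct I (initial I valid even determined) (required-q I valid even determined)
      t , run , t≤ = runs (encodeInstance I)
  in S , t , subst (λ s → Run (PolyTime.program F) (encodeInstance I) s t) solved run , t≤ , Sq≡Q , reduced

mainTheorem6 : ((I : Instance) → let open Instance I in
    Realizable ⇔ (TopologicallyValid × 2 ∣ length Q × DeterminedByTightWalks))
    ×
    (Σ[ P ∈ Program ] Σ[ c ∈ ℕ ] Σ[ k ∈ ℕ ]
    ((I : Instance) → let open Instance I in
    TopologicallyValid → 2 ∣ length Q → DeterminedByTightWalks →
    Σ[ S ∈ Recoloring α β ] Σ[ t ∈ ℕ ]
    ( Run P (encodeInstance I) (encodeRecoloring G H S) t
    × t ≤ c * size (encodeInstance I) ^ k + c
    × S at q ≡ Q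
    × (∀ v → Reduced (S at v)))))
mainTheorem6 = realizable⇔ , algorithm solveᴾ
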